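{- There is an absolute constant $c>0$ such that the following holds. Let $r\ge1$, $\delta>0$, and let $P_1,\dots,P_n\colon\mathbb{F}_2^m\to\mathbb{F}_2$ be functions with $\operatorname{rank}_1(P_i)\le r$ for all $i$. Suppose that for every $i$ and every affine subspace $V+h$ of $\mathbb{F}_2^m$, the distribution of $P_i(Y)$ for $Y$ uniform on $V+h$ has total variation distance at least $\delta$ from $\mathrm{Ber}(1/3)$. Let $\mathcal{P}$ be the distribution of $(P_1(X),\dots,P_n(X))$ for $X$ uniform on $\mathbb{F}_2^m$. Then \[ \|\mathcal{P}-\mathrm{Ber}(1/3)^{\otimes n}\|_{\mathtt{TV}}\ \ge\ 1-2^{ -\frac{c^r\delta^{2r}}{r!}\, n + r}. \]
   Context: For $P\colon\mathbb{F}_2^m\to\mathbb{F}_2$ not identically zero, $\operatorname{rank}_1(P)$ is the smallest positive integer $k$ such that $P=\Gamma(L_1,\dots,L_k)$ for some polynomials $L_1,\dots,L_k$ of degree at most $1$ and some function $\Gamma\colon\mathbb{F}_2^k\to\mathbb{F}_2$. Total variation distance: $\|\mathcal{D}_1-\mathcal{D}_2\|_{\mathtt{TV}}=\frac12\sum_x|\mathcal{D}_1(x)-\mathcal{D}_2(x)|$. -}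

module Defs where

open import Data.Bool.Base using (Bool; true; false; _∧_; _xor_; T)
import Data.Bool.Properties as Bool
open import Data.Fin.Base using (Fin)
open import Data.Integer.Base as ℤ using (ℤ; +_; -[1+_])
open import Data.List.Base using (List; []; _∷_; _++_; map; filter; foldr; length)
open import Data.List.Membership.Propositional using (_∈_)
open import Data.List.Membership.Propositional.Properties
  using (∈-map⁺; ∈-++⁺ˡ; ∈-filter⁺; ∈-length)
open import Data.List.Relation.Unary.Any using (here)
open import Data.Nat.Base as ℕ using (ℕ; zero; suc; _⊔_; _!; >-nonZero)
open import Data.Nat.Properties using (m⊔n≤o⇒m≤o; m⊔n≤o⇒n≤o; _!≢0; ≤-refl)
open import Data.Product.Base using (Σ-syntax; ∃-syntax; _×_; _,_)
open import Data.Rational.Base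
  using (ℚ; 0ℚ; 1ℚ; ½; _/_; _+_; _*_; -_; _-_; 1/_; ∣_∣; _≤_; _<_; ↥_; ↧ₙ_;
         Positive; positive; NonZero; +-*-rawSemiring)
open import Data.Rational.Properties as ℚ
  using (∣p+q∣≤∣p∣+∣q∣; ∣p*q∣≡∣p∣*∣q∣; ∣-p∣≡∣p∣; 0≤∣p∣; *-inverseʳ;
         +-mono-<; +-mono-<-≤; +-monoˡ-≤; *-monoʳ-<-pos; *-monoʳ-≤-nonNeg;
         positive⁻¹; pos*pos⇒pos; 1/pos⇒pos; pos⇒nonZero; <⇒≤)
open import Data.Sum.Base using (_⊎_)
open import Data.Vec.Base as Vec using (Vec; []; _∷_; zipWith; replicate; tabulate)
import Data.Vec.Properties as Vec
open import Algebra.Bundles using (module CommutativeMonoid)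
open import Algebra.Properties.CommutativeSemigroup
  (CommutativeMonoid.commutativeSemigroup ℚ.+-0-commutativeMonoid)
  using () renaming (interchange to +-interchange)
open import Algebra.Definitions.RawSemiring +-*-rawSemiring using (_^_)
open import Relation.Binary.Definitions using (DecidableEquality)
open import Relation.Binary.PropositionalEquality using (_≡_; refl; sym; trans; cong; cong₂; subst; module ≡-Reasoning)
open import Relation.Nullary.Decidable using (T?)

-- Real numbers as Cauchy sequences of rationals, compared up to the relations below.

record ℝ : Set where
  field
    seq    : ℕ → ℚ
    cauchy : ∀ ε → 0ℚ < ε →
             ∃[ N ] (∀ i j → N ℕ.≤ i → N ℕ.≤ j → ∣ seq i - seq j ∣ < ε)

open ℝ public

infix  4 _≤ᵣ_ _<ᵣ_
infixl 6 _+ᵣ_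
infixl 7 _*ᵣ_
infix  8 -ᵣ_
infixr 8 _^ᵣ_

_≤ᵣ_ : ℝ → ℝ → Set
x ≤ᵣ y = ∀ ε → 0ℚ < ε → ∃[ N ] (∀ i → N ℕ.≤ i → seq x i ≤ seq y i + ε)

_<ᵣ_ : ℝ → ℝ → Set
x <ᵣ y = ∃[ ε ] (0ℚ < ε × ∃[ N ] (∀ i → N ℕ.≤ i → seq x i + ε ≤ seq y i))

private
  half-pos : ∀ ε → 0ℚ < ε → 0ℚ < ½ * ε
  half-pos ε 0<ε = positive⁻¹ (½ * ε) {{pos*pos⇒pos ½ ε {{positive 0<ε}}}}

  half+half : ∀ ε → ½ * ε + ½ * ε ≡ ε
  half+half ε = trans (sym (ℚ.*-distribʳ-+ ε ½ ½)) (ℚ.*-identityˡ ε)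

  shift : ∀ a b → a ≡ (a - b) + b
  shift a b = sym (trans (ℚ.+-assoc a (- b) b)
                         (trans (cong (λ z → a + z) (ℚ.+-inverseˡ b)) (ℚ.+-identityʳ a)))

  neg-split : ∀ a b → (- a) - (- b) ≡ - (a - b)
  neg-split a b = sym (ℚ.neg-distrib-+ a (- b))

  +-split : ∀ a b c d → (a + b) - (c + d) ≡ (a - c) + (b - d)
  +-split a b c d = trans (cong (λ z → (a + b) + z) (ℚ.neg-distrib-+ c d)) (+-interchange a b (- c) (- d))

  *-split : ∀ a b c d → (a * b) - (c * d) ≡ a * (b - d) + d * (a - c)
  *-split a b c d = begin
    a * b - c * d                        ≡⟨ cong (λ z → z - c * d) (shift (a * b) (a * d)) ⟩
    ((a * b - a * d) + a * d) - c * d    ≡⟨ ℚ.+-assoc (a * b - a * d) (a * d) (- (c * d)) ⟩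
    (a * b - a * d) + (a * d - c * d)    ≡⟨ cong₂ _+_ (factor a b d)
                                              (trans (cong₂ _-_ (ℚ.*-comm a d) (ℚ.*-comm c d))
                                                     (factor d a c)) ⟩
    a * (b - d) + d * (a - c)            ∎
    where
    open ≡-Reasoning
    factor : ∀ p q s → p * q - p * s ≡ p * (q - s)
    factor p q s = trans (cong (λ z → p * q + z) (ℚ.neg-distribʳ-* p s)) (sym (ℚ.*-distribˡ-+ p q (- s)))

  0<1+ : ∀ q → 0ℚ < 1ℚ + ∣ q ∣
  0<1+ q = +-mono-<-≤ (positive⁻¹ 1ℚ) (0≤∣p∣ q)

  bounded : (x : ℝ) → ∃[ B ] (0ℚ < B × ∃[ N ] (∀ i → N ℕ.≤ i → ∣ seq x i ∣ ≤ B))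
  bounded x with cauchy x 1ℚ (positive⁻¹ 1ℚ)
  ... | N , close = 1ℚ + ∣ seq x N ∣ , 0<1+ (seq x N) , N , λ i N≤i → begin
    ∣ seq x i ∣                          ≡⟨ cong ∣_∣ (shift (seq x i) (seq x N)) ⟩
    ∣ (seq x i - seq x N) + seq x N ∣    ≤⟨ ∣p+q∣≤∣p∣+∣q∣ (seq x i - seq x N) (seq x N) ⟩
    ∣ seq x i - seq x N ∣ + ∣ seq x N ∣  ≤⟨ +-monoˡ-≤ ∣ seq x N ∣ (<⇒≤ (close i N N≤i ≤-refl)) ⟩
    1ℚ + ∣ seq x N ∣                     ∎
    where open ℚ.≤-Reasoning

  scaled : ∀ ε → 0ℚ < ε → ∀ B → 0ℚ < B →
           ∃[ η ] (0ℚ < η × (∀ a d → ∣ a ∣ ≤ B → ∣ d ∣ < η → ∣ a * d ∣ < ½ * ε))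
  scaled ε 0<ε B 0<B = η , positive⁻¹ η , bound
    where
    open ℚ.≤-Reasoning
    instance
      B>0 : Positive B
      B>0 = positive 0<B
      B≢0 : NonZero B
      B≢0 = pos⇒nonZero B
      ½ε>0 : Positive (½ * ε)
      ½ε>0 = positive (half-pos ε 0<ε)
      1/B>0 : Positive (1/ B)
      1/B>0 = 1/pos⇒pos B
    η : ℚ
    η = (½ * ε) * 1/ B
    instance
      η>0 : Positive η
      η>0 = pos*pos⇒pos (½ * ε) (1/ B)
    B*η : B * η ≡ ½ * ε
    B*η = trans (trans (sym (ℚ.*-assoc B (½ * ε) (1/ B)))
                       (trans (cong (_* 1/ B) (ℚ.*-comm B (½ * ε))) (ℚ.*-assoc (½ * ε) B (1/ B))))
                (trans (cong ((½ * ε) *_) (*-inverseʳ B)) (ℚ.*-identityʳ (½ * ε)))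
    bound : ∀ a d → ∣ a ∣ ≤ B → ∣ d ∣ < η → ∣ a * d ∣ < ½ * ε
    bound a d a≤B d<η = begin-strict
      ∣ a * d ∣      ≡⟨ ∣p*q∣≡∣p∣*∣q∣ a d ⟩
      ∣ a ∣ * ∣ d ∣  ≤⟨ *-monoʳ-≤-nonNeg ∣ d ∣ {{ℚ.∣-∣-nonNeg d}} a≤B ⟩
      B * ∣ d ∣      <⟨ *-monoʳ-<-pos B d<η ⟩
      B * η          ≡⟨ B*η ⟩
      ½ * ε          ∎

  triangle : ∀ ε a b → ∣ a ∣ < ½ * ε → ∣ b ∣ < ½ * ε → ∣ a + b ∣ < ε
  triangle ε a b a< b< = begin-strict
    ∣ a + b ∣      ≤⟨ ∣p+q∣≤∣p∣+∣q∣ a b ⟩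
    ∣ a ∣ + ∣ b ∣  <⟨ +-mono-< a< b< ⟩
    ½ * ε + ½ * ε  ≡⟨ half+half ε ⟩
    ε              ∎
    where open ℚ.≤-Reasoning

ι : ℚ → ℝ
ι q .seq _ = q
ι q .cauchy ε 0<ε = 0 , λ _ _ _ _ → subst (_< ε) (sym (cong ∣_∣ (ℚ.+-inverseʳ q))) 0<ε

_+ᵣ_ : ℝ → ℝ → ℝ
(x +ᵣ y) .seq i = seq x i + seq y i
(x +ᵣ y) .cauchy ε 0<ε
  with cauchy x (½ * ε) (half-pos ε 0<ε) | cauchy y (½ * ε) (half-pos ε 0<ε)
... | M , p | N , q = M ⊔ N , λ i j ≤i ≤j →
  subst (λ z → ∣ z ∣ < ε) (sym (+-split (seq x i) (seq y i) (seq x j) (seq y j)))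
    (triangle ε _ _ (p i j (m⊔n≤o⇒m≤o M N ≤i) (m⊔n≤o⇒m≤o M N ≤j))
                    (q i j (m⊔n≤o⇒n≤o M N ≤i) (m⊔n≤o⇒n≤o M N ≤j)))

-ᵣ_ : ℝ → ℝ
(-ᵣ x) .seq i = - seq x i
(-ᵣ x) .cauchy ε 0<ε with cauchy x ε 0<ε
... | N , p = N , λ i j ≤i ≤j →
  subst (_< ε) (sym (trans (cong ∣_∣ (neg-split (seq x i) (seq x j)))
                           (∣-p∣≡∣p∣ (seq x i - seq x j))))
    (p i j ≤i ≤j)

_*ᵣ_ : ℝ → ℝ → ℝ
(x *ᵣ y) .seq i = seq x i * seq y i
(x *ᵣ y) .cauchy ε 0<ε with bounded x | bounded y
... | B , 0<B , M , x≤B | C , 0<C , N , y≤C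
  with scaled ε 0<ε B 0<B | scaled ε 0<ε C 0<C
... | η , 0<η , f | θ , 0<θ , g
  with cauchy y η 0<η | cauchy x θ 0<θ
... | K , p | L , q = (M ⊔ N) ⊔ (K ⊔ L) , λ i j ≤i ≤j →
  let i₁ = m⊔n≤o⇒m≤o (M ⊔ N) (K ⊔ L) ≤i ; i₂ = m⊔n≤o⇒n≤o (M ⊔ N) (K ⊔ L) ≤i
      j₁ = m⊔n≤o⇒m≤o (M ⊔ N) (K ⊔ L) ≤j ; j₂ = m⊔n≤o⇒n≤o (M ⊔ N) (K ⊔ L) ≤j
  in subst (λ z → ∣ z ∣ < ε) (sym (*-split (seq x i) (seq y i) (seq x j) (seq y j)))
       (triangle ε _ _
         (f _ _ (x≤B i (m⊔n≤o⇒m≤o M N i₁)) (p i j (m⊔n≤o⇒m≤o K L i₂) (m⊔n≤o⇒m≤o K L j₂)))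
         (g _ _ (y≤C j (m⊔n≤o⇒n≤o M N j₁)) (q i j (m⊔n≤o⇒n≤o K L i₂) (m⊔n≤o⇒n≤o K L j₂))))

_^ᵣ_ : ℝ → ℕ → ℝ
x ^ᵣ zero  = ι 1ℚ
x ^ᵣ suc k = x *ᵣ x ^ᵣ k

fromℕ : ℕ → ℝ
fromℕ k = ι (+ k / 1)

1/_!ᵣ : ℕ → ℝ
1/ k !ᵣ = ι (_/_ (+ 1) (k !) {{k !≢0}})

-- Comparison with powers of two: 2^(a/b) is the nonnegative b-th root of 2^a, and for
-- real x, 2^x is the infimum of 2^p over the rationals p > x.

2^ℤ_ : ℤ → ℚ
2^ℤ (+ k)      = (+ 2 / 1) ^ k
2^ℤ (-[1+ k ]) = ½ ^ suc k

infix 4 _≤2^ℚ_ _≤2^_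

_≤2^ℚ_ : ℚ → ℚ → Set
y ≤2^ℚ p = y ≤ 0ℚ ⊎ y ^ (↧ₙ p) ≤ 2^ℤ (↥ p)

_≤2^_ : ℚ → ℝ → Set
y ≤2^ x = ∀ p → x <ᵣ ι p → y ≤2^ℚ p

𝔽₂ : Set
𝔽₂ = Bool

𝔽₂^ : ℕ → Set
𝔽₂^ m = Vec 𝔽₂ m

0ᵥ : ∀ {m} → 𝔽₂^ m
0ᵥ = replicate _ false

infixl 6 _⊕_

_⊕_ : ∀ {m} → 𝔽₂^ m → 𝔽₂^ m → 𝔽₂^ m
_⊕_ = zipWith _xor_

-- The polynomial b + a₁x₁ + ⋯ + aₘxₘ.

record Affine (m : ℕ) : Set where
  field
    coeff : 𝔽₂^ m
    const : 𝔽₂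

  eval : 𝔽₂^ m → 𝔽₂
  eval x = const xor Vec.foldr _ _xor_ false (zipWith _∧_ coeff x)

Factors : ∀ {m} → (𝔽₂^ m → 𝔽₂) → ℕ → Set
Factors {m} P k =
  Σ[ L ∈ Vec (Affine m) k ] Σ[ Γ ∈ (𝔽₂^ k → 𝔽₂) ]
    (∀ x → P x ≡ Γ (Vec.map (λ ℓ → Affine.eval ℓ x) L))

-- Rank₁ P k says that rank₁(P) = k; the zero function is given rank 0.

data Rank₁ {m : ℕ} (P : 𝔽₂^ m → 𝔽₂) : ℕ → Set where
  rank-zero    : (∀ x → P x ≡ false) → Rank₁ P 0
  rank-nonzero : ∀ {k} → (∃[ x ] P x ≡ true) →
                 1 ℕ.≤ k → Factors P k → (∀ j → 1 ℕ.≤ j → Factors P j → k ℕ.≤ j) →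
                 Rank₁ P k

-- Closure under scalars is automatic over 𝔽₂.

record Subspace (m : ℕ) : Set where
  field
    member   : 𝔽₂^ m → Bool
    0∈       : T (member 0ᵥ)
    ⊕-closed : ∀ u v → T (member u) → T (member v) → T (member (u ⊕ v))

open Subspace public

cube : (m : ℕ) → List (𝔽₂^ m)
cube zero    = [] ∷ []
cube (suc m) = map (false ∷_) (cube m) ++ map (true ∷_) (cube m)

coset : ∀ {m} → Subspace m → 𝔽₂^ m → List (𝔽₂^ m)
coset {m} V h = map (_⊕ h) (filter (λ v → T? (member V v)) (cube m))

private
  0ᵥ∈cube : ∀ m → 0ᵥ ∈ cube m
  0ᵥ∈cube zero    = here refl
  0ᵥ∈cube (suc m) = ∈-++⁺ˡ (∈-map⁺ (false ∷_) (0ᵥ∈cube m))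

cube-nonempty : ∀ m → ℕ.NonZero (length (cube m))
cube-nonempty m = >-nonZero (∈-length (0ᵥ∈cube m))

coset-nonempty : ∀ {m} (V : Subspace m) h → ℕ.NonZero (length (coset V h))
coset-nonempty {m} V h =
  >-nonZero (∈-length (∈-map⁺ (_⊕ h) (∈-filter⁺ (λ v → T? (member V v)) (0ᵥ∈cube m) (0∈ V))))

Dist : Set → Set
Dist A = A → ℚ

-- The law of f(X) for X uniform on the entries of a duplicate-free list.

law : ∀ {A B : Set} → DecidableEquality B → (xs : List A) → .{{ℕ.NonZero (length xs)}} →
      (A → B) → Dist B
law _≟_ xs f b = + length (filter (λ x → f x ≟ b) xs) / length xs

cosetLaw : ∀ {m} → Subspace m → 𝔽₂^ m → (𝔽₂^ m → 𝔽₂) → Dist 𝔽₂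
cosetLaw V h = law Bool._≟_ (coset V h) {{coset-nonempty V h}}

jointLaw : ∀ {m n} → (Fin n → 𝔽₂^ m → 𝔽₂) → Dist (𝔽₂^ n)
jointLaw {m} P =
  law (Vec.≡-dec Bool._≟_) (cube m) {{cube-nonempty m}} (λ x → tabulate (λ i → P i x))

Ber : ℚ → Dist 𝔽₂
Ber p true  = p
Ber p false = 1ℚ - p

_⊗^_ : Dist 𝔽₂ → (n : ℕ) → Dist (𝔽₂^ n)
(D ⊗^ n) x = Vec.foldr _ _*_ 1ℚ (Vec.map D x)

-- The first argument enumerates the sample space.

TV : ∀ {A : Set} → List A → Dist A → Dist A → ℚ
TV xs D₁ D₂ = ½ * foldr _+_ 0ℚ (map (λ x → ∣ D₁ x - D₂ x ∣) xs)

TV₁ : Dist 𝔽₂ → Dist 𝔽₂ → ℚ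
TV₁ = TV (false ∷ true ∷ [])

TVⁿ : ∀ {n} → Dist (𝔽₂^ n) → Dist (𝔽₂^ n) → ℚ
TVⁿ {n} = TV (cube n)

⅓ : ℚ
⅓ = + 1 / 3

-- The quantity to bound is the affinity Σ_y min(p(y), q(y)) = 1 − TV of the output law p and
-- q = Ber(1/3)^n, on every coset h + V. Let the functions have rank at most r on h + V and choose
-- greedily functions P_i whose linear forms are jointly independent over V.
--
-- If many are chosen, their outputs are independent, and each is δ-far from Ber(1/3). A weight
-- t(y) = ∏ t_i(y_i) and its inverse u then satisfy min(p, q) ≤ t p + u q, where both sums are
-- products with every factor at most 1 − Ω(δ²).
--
-- If few are chosen, say k, fix all their forms. This splits the coset into at most 2^(kr) cosets;
-- on each of them every other function has lost a form, because its forms became dependent, so all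
-- ranks are at most r − 1. The affinity of a mixture is at most the sum of the affinities, so it
-- suffices to gain more than the factor 2^(kr) by induction.
--
-- The induction shows that the affinity is at most 2^(-s) whenever n ≥ s D_r, where D_r is
-- 14 (4N)^r r! and N is of order δ^(-2); the term + r in the exponent absorbs the rounding of n / D_r.

module Submission where

open import Defs
open import Algebra.Bundles using (module CommutativeRing)
open import Data.Bool.Base using (Bool; true; false; if_then_else_; _∧_; _xor_; not; T)
import Data.Bool.Properties as Bool
open import Data.Bool.Solver using (module xor-∧-Solver)
open import Data.Empty using (⊥-elim)
open import Data.Fin.Base using (Fin; zero; suc)
open import Data.Integer.Base as ℤ using (ℤ; +_; -[1+_])
import Data.Integer.Properties as ℤ
open import Data.List.Base as List using (List; []; _∷_; length)
import Data.List.Properties as List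
open import Data.List.Relation.Unary.All using (All; []; _∷_)
open import Data.Nat.Base as ℕ using (ℕ; zero; suc; _!)
import Data.Nat.Coprimality as Coprime
import Data.Nat.DivMod as ℕ
import Data.Nat.Properties as ℕ
open import Data.Nat.Solver using () renaming (module +-*-Solver to ℕ-Solver)
open import Data.Product.Base using (_×_; _,_; ∃-syntax; proj₁; proj₂)
open import Data.Rational.Base
  using (ℚ; mkℚ; 0ℚ; 1ℚ; ½; _/_; _+_; _*_; -_; _-_; 1/_; _≤_; _<_; *≤*; _⊓_; ∣_∣; toℚᵘ;
         Positive; NonNegative; positive; nonNegative; +-*-rawSemiring)
open import Data.Rational.Properties as ℚ using (≤-trans; ≤-refl; ≤-reflexive; +-mono-≤)
open import Data.Rational.Solver using (module +-*-Solver)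
open import Data.Rational.Unnormalised.Base as ℚᵘ using (mkℚᵘ)
import Data.Rational.Unnormalised.Properties as ℚᵘ
open import Data.Sum.Base using (_⊎_; inj₁; inj₂)
open import Data.Unit.Base using (tt)
open import Data.Vec.Base as Vec using (Vec; []; _∷_)
import Data.Vec.Properties as Vec
open import Algebra.Definitions.RawSemiring +-*-rawSemiring using (_^_)
open import Algebra.Properties.CommutativeSemiring.Exp
  (CommutativeRing.commutativeSemiring ℚ.+-*-commutativeRing)
  using (^-homo-*; ^-assocʳ; ^-distrib-*)
open import Function.Base using (_∘_)
open import Function.Bundles using (Equivalence)
open import Relation.Binary.Definitions using (DecidableEquality)
open import Relation.Binary.PropositionalEquality
open import Relation.Nullary.Decidable using (does; yes; no; toWitness; T?)
open import Relation.Unary using (Decidable)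
open +-*-Solver using (solve; _:=_; _:+_; _:*_; :-_; _:-_; con)

-- Inequalities between rationals.

-- The explicit difference `d` reduces an inequality to a ring identity for the solver and a sum of
-- visibly nonnegative terms.
≤-by : ∀ {p q} d → 0ℚ ≤ d → p + d ≡ q → p ≤ q
≤-by {p} d 0≤d refl = ≤-trans (≤-reflexive (sym (ℚ.+-identityʳ p))) (ℚ.+-monoʳ-≤ p 0≤d)

*-nonneg : ∀ {p q} → 0ℚ ≤ p → 0ℚ ≤ q → 0ℚ ≤ p * q
*-nonneg {p} {q} 0≤p 0≤q =
  ≤-trans (≤-reflexive (sym (ℚ.*-zeroʳ p))) (ℚ.*-monoˡ-≤-nonNeg p {{nonNegative 0≤p}} 0≤q)

+-nonneg : ∀ {p q} → 0ℚ ≤ p → 0ℚ ≤ q → 0ℚ ≤ p + q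
+-nonneg = +-mono-≤

*-monoˡ : ∀ {p q} r → 0ℚ ≤ r → p ≤ q → r * p ≤ r * q
*-monoˡ r 0≤r = ℚ.*-monoˡ-≤-nonNeg r {{nonNegative 0≤r}}

*-mono : ∀ {p q r s} → 0ℚ ≤ p → 0ℚ ≤ s → p ≤ q → r ≤ s → p * r ≤ q * s
*-mono {p} {q} {r} {s} 0≤p 0≤s p≤q r≤s =
  ≤-trans (*-monoˡ p 0≤p r≤s) (ℚ.*-monoʳ-≤-nonNeg s {{nonNegative 0≤s}} p≤q)

p-q≥0 : ∀ {p q} → p ≤ q → 0ℚ ≤ q - p
p-q≥0 {p} {q} p≤q = ≤-trans (≤-reflexive (sym (ℚ.+-inverseʳ p))) (ℚ.+-monoˡ-≤ (- p) p≤q)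

-- Sums over the cube

-- Recursion on the dimension, so that splitting off one coordinate is a computation; `sum-cube`
-- returns to the list `cube n`.
∑ : ∀ {n} → (𝔽₂^ n → ℚ) → ℚ
∑ {zero}  F = F []
∑ {suc n} F = ∑ (F ∘ (false ∷_)) + ∑ (F ∘ (true ∷_))

∑-cong : ∀ {n} {F G : 𝔽₂^ n → ℚ} → (∀ x → F x ≡ G x) → ∑ F ≡ ∑ G
∑-cong {zero}  eq = eq []
∑-cong {suc n} eq = cong₂ _+_ (∑-cong (eq ∘ (false ∷_))) (∑-cong (eq ∘ (true ∷_)))

∑-mono : ∀ {n} {F G : 𝔽₂^ n → ℚ} → (∀ x → F x ≤ G x) → ∑ F ≤ ∑ G
∑-mono {zero}  le = le []
∑-mono {suc n} le = +-mono-≤ (∑-mono (le ∘ (false ∷_))) (∑-mono (le ∘ (true ∷_)))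

∑-nonneg : ∀ {n} {F : 𝔽₂^ n → ℚ} → (∀ x → 0ℚ ≤ F x) → 0ℚ ≤ ∑ F
∑-nonneg {zero}  le = le []
∑-nonneg {suc n} le = +-nonneg (∑-nonneg (le ∘ (false ∷_))) (∑-nonneg (le ∘ (true ∷_)))

+-interchange : ∀ a b c d → (a + b) + (c + d) ≡ (a + c) + (b + d)
+-interchange = solve 4 (λ a b c d → (a :+ b) :+ (c :+ d) := (a :+ c) :+ (b :+ d)) refl

∑-+ : ∀ {n} (F G : 𝔽₂^ n → ℚ) → ∑ (λ x → F x + G x) ≡ ∑ F + ∑ G
∑-+ {zero}  F G = refl
∑-+ {suc n} F G = trans (cong₂ _+_ (∑-+ (F ∘ (false ∷_)) (G ∘ (false ∷_)))
                                   (∑-+ (F ∘ (true ∷_)) (G ∘ (true ∷_))))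
                        (+-interchange (∑ (F ∘ (false ∷_))) _ _ _)

∑-* : ∀ {n} c (F : 𝔽₂^ n → ℚ) → ∑ (λ x → c * F x) ≡ c * ∑ F
∑-* {zero}  c F = refl
∑-* {suc n} c F = trans (cong₂ _+_ (∑-* c (F ∘ (false ∷_))) (∑-* c (F ∘ (true ∷_))))
                        (sym (ℚ.*-distribˡ-+ c _ _))

∑-swap : ∀ {m n} (F : 𝔽₂^ m → 𝔽₂^ n → ℚ) →
         ∑ (λ x → ∑ (F x)) ≡ ∑ (λ y → ∑ (λ x → F x y))
∑-swap {zero}  F = refl
∑-swap {suc m} F = trans (cong₂ _+_ (∑-swap (F ∘ (false ∷_))) (∑-swap (F ∘ (true ∷_))))
                         (sym (∑-+ (λ y → ∑ (λ x → F (false ∷ x) y)) (λ y → ∑ (λ x → F (true ∷ x) y))))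

∑-shift : ∀ {n} (F : 𝔽₂^ n → ℚ) a → ∑ (λ x → F (x ⊕ a)) ≡ ∑ F
∑-shift {zero}  F []          = refl
∑-shift {suc n} F (false ∷ a) = cong₂ _+_ (∑-shift (F ∘ (false ∷_)) a) (∑-shift (F ∘ (true ∷_)) a)
∑-shift {suc n} F (true ∷ a)  =
  trans (cong₂ _+_ (∑-shift (F ∘ (true ∷_)) a) (∑-shift (F ∘ (false ∷_)) a)) (ℚ.+-comm (∑ (F ∘ (true ∷_))) _)

∑-term : ∀ {n} {F : 𝔽₂^ n → ℚ} → (∀ x → 0ℚ ≤ F x) → ∀ z → F z ≤ ∑ F
∑-term {zero}      le []          = ≤-refl
∑-term {suc n} {F} le (false ∷ z) =
  ≤-trans (∑-term (le ∘ (false ∷_)) z)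
          (≤-by (∑ (F ∘ (true ∷_))) (∑-nonneg (le ∘ (true ∷_))) refl)
∑-term {suc n} {F} le (true ∷ z) =
  ≤-trans (∑-term (le ∘ (true ∷_)) z)
          (≤-by (∑ (F ∘ (false ∷_))) (∑-nonneg (le ∘ (false ∷_))) (ℚ.+-comm (∑ (F ∘ (true ∷_))) _))

sumℚ : List ℚ → ℚ
sumℚ = List.foldr _+_ 0ℚ

sumℚ-++ : ∀ xs ys → sumℚ (xs List.++ ys) ≡ sumℚ xs + sumℚ ys
sumℚ-++ []       ys = sym (ℚ.+-identityˡ _)
sumℚ-++ (x ∷ xs) ys = trans (cong (λ z → x + z) (sumℚ-++ xs ys)) (sym (ℚ.+-assoc x _ _))

sum-cube : ∀ {n} (F : 𝔽₂^ n → ℚ) → sumℚ (List.map F (cube n)) ≡ ∑ F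
sum-cube {zero}  F = ℚ.+-identityʳ (F [])
sum-cube {suc n} F = begin
  sumℚ (List.map F (List.map (false ∷_) (cube n) List.++ List.map (true ∷_) (cube n)))
    ≡⟨ cong sumℚ (List.map-++ F (List.map (false ∷_) (cube n)) _) ⟩
  sumℚ (List.map F (List.map (false ∷_) (cube n)) List.++ List.map F (List.map (true ∷_) (cube n)))
    ≡⟨ sumℚ-++ (List.map F (List.map (false ∷_) (cube n))) _ ⟩
  sumℚ (List.map F (List.map (false ∷_) (cube n))) + sumℚ (List.map F (List.map (true ∷_) (cube n)))
    ≡⟨ cong₂ (λ a b → sumℚ a + sumℚ b) (sym (List.map-∘ (cube n))) (sym (List.map-∘ (cube n))) ⟩
  sumℚ (List.map (F ∘ (false ∷_)) (cube n)) + sumℚ (List.map (F ∘ (true ∷_)) (cube n))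
    ≡⟨ cong₂ _+_ (sum-cube (F ∘ (false ∷_))) (sum-cube (F ∘ (true ∷_))) ⟩
  ∑ F ∎
  where open ≡-Reasoning

𝟙 : Bool → ℚ
𝟙 b = if b then 1ℚ else 0ℚ

𝟙-nonneg : ∀ b → 0ℚ ≤ 𝟙 b
𝟙-nonneg true  = ℚ.nonNegative⁻¹ 1ℚ
𝟙-nonneg false = ≤-refl

_≡ᵇ_ : ∀ {n} → 𝔽₂^ n → 𝔽₂^ n → Bool
x ≡ᵇ y = does (Vec.≡-dec Bool._≟_ x y)

∑-zero : ∀ {n} (F : 𝔽₂^ n → ℚ) → ∑ (λ x → 0ℚ * F x) ≡ 0ℚ
∑-zero F = trans (∑-* 0ℚ F) (ℚ.*-zeroˡ (∑ F))

∑-point : ∀ {n} z (F : 𝔽₂^ n → ℚ) → ∑ (λ y → 𝟙 (z ≡ᵇ y) * F y) ≡ F z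
∑-point []          F = ℚ.*-identityˡ (F [])
∑-point (false ∷ z) F = trans (cong₂ _+_ (∑-point z (F ∘ (false ∷_))) (∑-zero (F ∘ (true ∷_)))) (ℚ.+-identityʳ _)
∑-point (true ∷ z)  F = trans (cong₂ _+_ (∑-zero (F ∘ (false ∷_))) (∑-point z (F ∘ (true ∷_)))) (ℚ.+-identityˡ _)

-- Powers and the embedding of the integers

^-nonneg : ∀ {q} → 0ℚ ≤ q → ∀ j → 0ℚ ≤ q ^ j
^-nonneg 0≤q zero    = ℚ.nonNegative⁻¹ 1ℚ
^-nonneg 0≤q (suc j) = *-nonneg 0≤q (^-nonneg 0≤q j)

^-mono : ∀ {p q} → 0ℚ ≤ p → p ≤ q → ∀ j → p ^ j ≤ q ^ j
^-mono 0≤p p≤q zero    = ≤-refl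
^-mono 0≤p p≤q (suc j) = *-mono 0≤p (^-nonneg (≤-trans 0≤p p≤q) j) p≤q (^-mono 0≤p p≤q j)

1^ : ∀ j → 1ℚ ^ j ≡ 1ℚ
1^ zero    = refl
1^ (suc j) = trans (ℚ.*-identityˡ (1ℚ ^ j)) (1^ j)

^≤1 : ∀ {q} → 0ℚ ≤ q → q ≤ 1ℚ → ∀ j → q ^ j ≤ 1ℚ
^≤1 0≤q q≤1 j = ≤-trans (^-mono 0≤q q≤1 j) (≤-reflexive (1^ j))

^-antitone : ∀ {q} → 0ℚ ≤ q → q ≤ 1ℚ → ∀ {i j} → i ℕ.≤ j → q ^ j ≤ q ^ i
^-antitone 0≤q q≤1 {j = j} ℕ.z≤n = ^≤1 0≤q q≤1 j
^-antitone {q} 0≤q q≤1 (ℕ.s≤s i≤j) = *-monoˡ q 0≤q (^-antitone 0≤q q≤1 i≤j)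

2ℚ : ℚ
2ℚ = 1ℚ + 1ℚ

½-nonneg : 0ℚ ≤ ½
½-nonneg = ℚ.nonNegative⁻¹ ½

2-nonneg : 0ℚ ≤ 2ℚ
2-nonneg = ℚ.nonNegative⁻¹ 2ℚ

1≤2^ : ∀ k → 1ℚ ≤ 2ℚ ^ k
1≤2^ k = ≤-trans (≤-reflexive (sym (1^ k))) (^-mono (ℚ.nonNegative⁻¹ 1ℚ) (toWitness {a? = 1ℚ ℚ.≤? 2ℚ} _) k)

2^-mono : ∀ {i j} → i ℕ.≤ j → 2ℚ ^ i ≤ 2ℚ ^ j
2^-mono {j = j} ℕ.z≤n     = 1≤2^ j
2^-mono         (ℕ.s≤s i≤j) = *-monoˡ 2ℚ 2-nonneg (2^-mono i≤j)

½≤1 : ½ ≤ 1ℚ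
½≤1 = toWitness {a? = ½ ℚ.≤? 1ℚ} _

-- `ρ ^ k` is at most the square of ½^(s+1), and one of the two factors pays for the doubling in
-- `ρ ^ k + ρ ^ k`.
decay : ∀ {ρ} → 0ℚ ≤ ρ → ρ ≤ 1ℚ → ∀ {N} → ρ ^ N ≤ ½ → ∀ s {k} →
        suc s ℕ.* (2 ℕ.* N) ℕ.≤ k → ρ ^ k + ρ ^ k ≤ ½ ^ suc s
decay {ρ} 0≤ρ ρ≤1 {N} ρ^N≤½ s {k} le = begin
  ρ ^ k + ρ ^ k     ≤⟨ +-mono-≤ bound bound ⟩
  a * a + a * a     ≡⟨ solve 1 (λ b → (con ½ :* b) :* (con ½ :* b) :+ (con ½ :* b) :* (con ½ :* b) := (con ½ :* b) :* b) refl (½ ^ s) ⟩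
  a * ½ ^ s         ≤⟨ *-monoˡ a (^-nonneg ½-nonneg (suc s)) (^≤1 ½-nonneg ½≤1 s) ⟩
  a * 1ℚ            ≡⟨ ℚ.*-identityʳ a ⟩
  ½ ^ suc s         ∎
  where
  open ℚ.≤-Reasoning
  a = ½ ^ suc s
  bound : ρ ^ k ≤ a * a
  bound = begin
    ρ ^ k                            ≤⟨ ^-antitone 0≤ρ ρ≤1 le ⟩
    ρ ^ (suc s ℕ.* (2 ℕ.* N))        ≡⟨ cong (ρ ^_) (ℕ-Solver.solve 2 (λ s N → s ℕ-Solver.:* (ℕ-Solver.con 2 ℕ-Solver.:* N) ℕ-Solver.:= N ℕ-Solver.:* (s ℕ-Solver.:+ s)) refl (suc s) N) ⟩
    ρ ^ (N ℕ.* (suc s ℕ.+ suc s))    ≡⟨ sym (^-assocʳ ρ N (suc s ℕ.+ suc s)) ⟩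
    (ρ ^ N) ^ (suc s ℕ.+ suc s)      ≤⟨ ^-mono (^-nonneg 0≤ρ N) ρ^N≤½ (suc s ℕ.+ suc s) ⟩
    ½ ^ (suc s ℕ.+ suc s)            ≡⟨ ^-homo-* ½ (suc s) (suc s) ⟩
    a * a                            ∎

2^*½^ : ∀ j → 2ℚ ^ j * ½ ^ j ≡ 1ℚ
2^*½^ j = trans (sym (^-distrib-* 2ℚ ½ j)) (1^ j)

fromℤ : ℤ → ℚ
fromℤ i = i / 1

fromℤ-mkℚ : ∀ i → mkℚ i 0 (Coprime.sym (Coprime.1-coprimeTo ℤ.∣ i ∣)) ≡ fromℤ i
fromℤ-mkℚ i = sym (ℚ.↥p/↧p≡p (mkℚ i 0 _))

fromℤ-+ : ∀ i j → fromℤ (i ℤ.+ j) ≡ fromℤ i + fromℤ j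
fromℤ-+ i j = trans (cong fromℤ (sym (cong₂ ℤ._+_ (ℤ.*-identityʳ i) (ℤ.*-identityʳ j))))
                    (cong₂ _+_ (fromℤ-mkℚ i) (fromℤ-mkℚ j))

fromℤ-* : ∀ i j → fromℤ (i ℤ.* j) ≡ fromℤ i * fromℤ j
fromℤ-* i j = cong₂ _*_ (fromℤ-mkℚ i) (fromℤ-mkℚ j)

fromℤ-mono : ∀ {i j} → i ℤ.≤ j → fromℤ i ≤ fromℤ j
fromℤ-mono {i} {j} i≤j = subst₂ _≤_ (fromℤ-mkℚ i) (fromℤ-mkℚ j)
  (*≤* (subst₂ ℤ._≤_ (sym (ℤ.*-identityʳ i)) (sym (ℤ.*-identityʳ j)) i≤j))

fromℤ-cancel-≤ : ∀ {i j} → fromℤ i ≤ fromℤ j → i ℤ.≤ j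
fromℤ-cancel-≤ {i} {j} le = subst₂ ℤ._≤_ (ℤ.*-identityʳ i) (ℤ.*-identityʳ j)
  (ℚ.drop-*≤* (subst₂ _≤_ (sym (fromℤ-mkℚ i)) (sym (fromℤ-mkℚ j)) le))

ℕ→ℚ : ℕ → ℚ
ℕ→ℚ k = fromℤ (+ k)

ℕ→ℚ-nonneg : ∀ k → 0ℚ ≤ ℕ→ℚ k
ℕ→ℚ-nonneg k = fromℤ-mono {+ 0} {+ k} (ℤ.+≤+ ℕ.z≤n)

ℕ→ℚ-mono : ∀ {i j} → i ℕ.≤ j → ℕ→ℚ i ≤ ℕ→ℚ j
ℕ→ℚ-mono i≤j = fromℤ-mono (ℤ.+≤+ i≤j)

ℕ→ℚ-* : ∀ i j → ℕ→ℚ (i ℕ.* j) ≡ ℕ→ℚ i * ℕ→ℚ j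
ℕ→ℚ-* i j = trans (cong fromℤ (ℤ.pos-* i j)) (fromℤ-* (+ i) (+ j))

ℕ→ℚ-+ : ∀ i j → ℕ→ℚ (i ℕ.+ j) ≡ ℕ→ℚ i + ℕ→ℚ j
ℕ→ℚ-+ i j = fromℤ-+ (+ i) (+ j)

-- Bernoulli's inequality as (1 - x)^j ≤ 1/(1 + jx), cleared of the division; each step of the
-- induction discards the term (1 + j)x² times (1 - x)^j.
bernoulli : ∀ x → 0ℚ ≤ x → 0ℚ ≤ 1ℚ - x → ∀ j → (1ℚ - x) ^ j * (1ℚ + ℕ→ℚ j * x) ≤ 1ℚ
bernoulli x 0≤x x≤1 zero    = ≤-reflexive (solve 1 (λ x → con 1ℚ :* (con 1ℚ :+ con 0ℚ :* x) := con 1ℚ) refl x)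
bernoulli x 0≤x x≤1 (suc j) = begin
  (1ℚ - x) * q * (1ℚ + ℕ→ℚ (suc j) * x)
    ≡⟨ cong (λ y → (1ℚ - x) * q * (1ℚ + y * x)) (ℕ→ℚ-+ 1 j) ⟩
  (1ℚ - x) * q * (1ℚ + (1ℚ + ℕ→ℚ j) * x)
    ≤⟨ ≤-by (q * ((1ℚ + ℕ→ℚ j) * (x * x)))
         (*-nonneg (^-nonneg x≤1 j) (*-nonneg (+-nonneg (ℚ.nonNegative⁻¹ 1ℚ) (ℕ→ℚ-nonneg j)) (*-nonneg 0≤x 0≤x)))
         (solve 3 (λ x q j → (con 1ℚ :- x) :* q :* (con 1ℚ :+ (con 1ℚ :+ j) :* x) :+ q :* ((con 1ℚ :+ j) :* (x :* x))
                          := q :* (con 1ℚ :+ j :* x)) refl x q (ℕ→ℚ j)) ⟩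
  q * (1ℚ + ℕ→ℚ j * x)
    ≤⟨ bernoulli x 0≤x x≤1 j ⟩
  1ℚ ∎
  where
  open ℚ.≤-Reasoning
  q = (1ℚ - x) ^ j

power≤½ : ∀ x → 0ℚ ≤ x → 0ℚ ≤ 1ℚ - x → ∀ N → 1ℚ ≤ ℕ→ℚ N * x → (1ℚ - x) ^ N ≤ ½
power≤½ x 0≤x x≤1 N 1≤Nx = begin
  q                          ≡⟨ solve 1 (λ q → q := con ½ :* (q :* (con 1ℚ :+ con 1ℚ))) refl q ⟩
  ½ * (q * (1ℚ + 1ℚ))        ≤⟨ *-monoˡ ½ ½-nonneg (*-monoˡ q (^-nonneg x≤1 N) (ℚ.+-monoʳ-≤ 1ℚ 1≤Nx)) ⟩
  ½ * (q * (1ℚ + ℕ→ℚ N * x)) ≤⟨ *-monoˡ ½ ½-nonneg (bernoulli x 0≤x x≤1 N) ⟩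
  ½                          ∎
  where
  open ℚ.≤-Reasoning
  q = (1ℚ - x) ^ N

-- Vectors, linear forms and subspaces over the field with two elements.

⊕-comm : ∀ {m} (x y : 𝔽₂^ m) → x ⊕ y ≡ y ⊕ x
⊕-comm = Vec.zipWith-comm Bool.xor-comm

⊕-assoc : ∀ {m} (x y z : 𝔽₂^ m) → (x ⊕ y) ⊕ z ≡ x ⊕ (y ⊕ z)
⊕-assoc = Vec.zipWith-assoc Bool.xor-assoc

⊕-identityʳ : ∀ {m} (x : 𝔽₂^ m) → x ⊕ 0ᵥ ≡ x
⊕-identityʳ = Vec.zipWith-identityʳ Bool.xor-identityʳ

⊕-self : ∀ {m} (x : 𝔽₂^ m) → x ⊕ x ≡ 0ᵥ
⊕-self []      = refl
⊕-self (b ∷ x) = cong₂ _∷_ (Bool.xor-same b) (⊕-self x)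

⊕-cancelʳ : ∀ {m} (x y : 𝔽₂^ m) → (x ⊕ y) ⊕ y ≡ x
⊕-cancelʳ x y = trans (⊕-assoc x y y) (trans (cong (x ⊕_) (⊕-self y)) (⊕-identityʳ x))

⊕-cancelˡ : ∀ {m} (x y : 𝔽₂^ m) → (x ⊕ y) ⊕ x ≡ y
⊕-cancelˡ x y = trans (cong (_⊕ x) (⊕-comm x y)) (⊕-cancelʳ y x)

⊕-swapʳ : ∀ {m} (x y z : 𝔽₂^ m) → (x ⊕ y) ⊕ z ≡ (x ⊕ z) ⊕ y
⊕-swapʳ x y z = trans (⊕-assoc x y z) (trans (cong (x ⊕_) (⊕-comm y z)) (sym (⊕-assoc x z y)))

⊕-chain : ∀ {m} (x y z : 𝔽₂^ m) → (x ⊕ y) ⊕ (y ⊕ z) ≡ x ⊕ z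
⊕-chain x y z = trans (sym (⊕-assoc (x ⊕ y) y z)) (cong (_⊕ z) (⊕-cancelʳ x y))

dot : ∀ {m} → 𝔽₂^ m → 𝔽₂^ m → 𝔽₂
dot a x = Vec.foldr _ _xor_ false (Vec.zipWith _∧_ a x)

dot-⊕ : ∀ {m} (a x y : 𝔽₂^ m) → dot a (x ⊕ y) ≡ dot a x xor dot a y
dot-⊕ []      []      []      = refl
dot-⊕ (a ∷ as) (x ∷ xs) (y ∷ ys) =
  trans (cong ((a ∧ (x xor y)) xor_) (dot-⊕ as xs ys))
        (S.solve 5 (λ a x y d e → (a S.:* (x S.:+ y)) S.:+ (d S.:+ e)
                            S.:= ((a S.:* x) S.:+ d) S.:+ ((a S.:* y) S.:+ e)) refl a x y (dot as xs) (dot as ys))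
  where module S = xor-∧-Solver

dot-0 : ∀ {m} (a : 𝔽₂^ m) → dot a 0ᵥ ≡ false
dot-0 []       = refl
dot-0 (a ∷ as) = trans (cong ((a ∧ false) xor_) (dot-0 as)) (cong (_xor false) (Bool.∧-zeroʳ a))

infix 4 _∈_ _∈_⊞_ _⊆_
infixl 6 _∩_ _∩*_

-- Wrapped in a record because `T (member V v)` unfolds: the wrapper keeps `V` and `v` inferable.
record _∈_ {m} (v : 𝔽₂^ m) (V : Subspace m) : Set where
  constructor ⟨_⟩
  field holds : T (member V v)

open _∈_ public

∈⇒≡ : ∀ {m} {V : Subspace m} {v} → v ∈ V → member V v ≡ true
∈⇒≡ ⟨ p ⟩ = Equivalence.to Bool.T-≡ p

≡⇒∈ : ∀ {m} {V : Subspace m} {v} → member V v ≡ true → v ∈ V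
≡⇒∈ p = ⟨ Equivalence.from Bool.T-≡ p ⟩

0ᵥ∈ : ∀ {m} (V : Subspace m) → 0ᵥ ∈ V
0ᵥ∈ V = ⟨ 0∈ V ⟩

⊕∈ : ∀ {m} {V : Subspace m} {u v} → u ∈ V → v ∈ V → u ⊕ v ∈ V
⊕∈ {V = V} ⟨ p ⟩ ⟨ q ⟩ = ⟨ ⊕-closed V _ _ p q ⟩

-- x lies in the coset h + V.
_∈_⊞_ : ∀ {m} → 𝔽₂^ m → 𝔽₂^ m → Subspace m → Set
x ∈ h ⊞ V = x ⊕ h ∈ V

_⊆_ : ∀ {m} → Subspace m → Subspace m → Set
V ⊆ W = ∀ {v} → v ∈ V → v ∈ W

_∩_ : ∀ {m} → Subspace m → 𝔽₂^ m → Subspace m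
member   (V ∩ l) v = member V v ∧ not (dot l v)
0∈       (V ∩ l) = Equivalence.from Bool.T-∧ (0∈ V , subst (T ∘ not) (sym (dot-0 l)) tt)
⊕-closed (V ∩ l) u v p q with Equivalence.to Bool.T-∧ p | Equivalence.to Bool.T-∧ q
... | u∈V , lu | v∈V , lv = Equivalence.from Bool.T-∧ (⊕-closed V u v u∈V v∈V , lemma (dot l u) (dot l v) (dot-⊕ l u v) lu lv)
  where
  lemma : ∀ {c} a b → c ≡ a xor b → T (not a) → T (not b) → T (not c)
  lemma false false refl _ _ = tt

_∩*_ : ∀ {m} → Subspace m → List (𝔽₂^ m) → Subspace m
V ∩* []      = V
V ∩* (l ∷ L) = (V ∩ l) ∩* L

∩-intro : ∀ {m} (V : Subspace m) l {v} → v ∈ V → dot l v ≡ false → v ∈ V ∩ l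
∩-intro V l ⟨ v∈V ⟩ lv = ⟨ Equivalence.from Bool.T-∧ (v∈V , subst (T ∘ not) (sym lv) tt) ⟩

∩-elim : ∀ {m} (V : Subspace m) l {v} → v ∈ V ∩ l → v ∈ V × dot l v ≡ false
∩-elim V l {v} ⟨ v∈ ⟩ with Equivalence.to Bool.T-∧ v∈
... | v∈V , lv = ⟨ v∈V ⟩ , lemma (dot l v) lv
  where
  lemma : ∀ b → T (not b) → b ≡ false
  lemma false _ = refl

∩⊆ : ∀ {m} (V : Subspace m) l → V ∩ l ⊆ V
∩⊆ V l v∈ = proj₁ (∩-elim V l v∈)

∩-mono : ∀ {m} {V W : Subspace m} l → V ⊆ W → V ∩ l ⊆ W ∩ l
∩-mono {V = V} {W} l V⊆W v∈ with ∩-elim V l v∈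
... | v∈V , lv = ∩-intro W l (V⊆W v∈V) lv

_⟂_ : ∀ {m} → 𝔽₂^ m → List (𝔽₂^ m) → Set
v ⟂ L = All (λ l → dot l v ≡ false) L

∩*-elim : ∀ {m} (V : Subspace m) L {v} → v ∈ V ∩* L → v ∈ V × v ⟂ L
∩*-elim V []      v∈ = v∈ , []
∩*-elim V (l ∷ L) v∈ with ∩*-elim (V ∩ l) L v∈
... | v∈Vl , v⟂L with ∩-elim V l v∈Vl
... | v∈V , lv = v∈V , lv ∷ v⟂L

∈-respˡ : ∀ {m} (V : Subspace m) {u v} → u ≡ v → u ∈ V → v ∈ V
∈-respˡ V refl p = p

self∈ : ∀ {m} (V : Subspace m) h → h ∈ h ⊞ V
self∈ V h = ∈-respˡ V (sym (⊕-self h)) (0ᵥ∈ V)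

∈⊞-trans : ∀ {m} (V : Subspace m) {x y z} → x ∈ y ⊞ V → y ∈ z ⊞ V → x ∈ z ⊞ V
∈⊞-trans V {x} {y} {z} p q = ∈-respˡ V (⊕-chain x y z) (⊕∈ p q)

∈⊞-shift : ∀ {m} (V : Subspace m) h {v} → v ∈ V → h ⊕ v ∈ h ⊞ V
∈⊞-shift V h {v} v∈V = ∈-respˡ V (sym (⊕-cancelˡ h v)) v∈V

member-shift : ∀ {m} (V : Subspace m) {v} → v ∈ V → ∀ u → member V (u ⊕ v) ≡ member V u
member-shift V {v} v∈V u = Bool.⇔→≡ {member V (u ⊕ v)} {member V u} {true} record
  { to        = λ p → ∈⇒≡ (∈-respˡ V (⊕-cancelʳ u v) (⊕∈ (≡⇒∈ {V = V} p) v∈V))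
  ; from      = λ p → ∈⇒≡ (⊕∈ (≡⇒∈ {V = V} p) v∈V)
  ; to-cong   = cong _
  ; from-cong = cong _
  }

-- Averages over cosets

mass : ∀ {m} → Subspace m → ℚ
mass V = ∑ (𝟙 ∘ member V)

total : ∀ {m} → Subspace m → 𝔽₂^ m → (𝔽₂^ m → ℚ) → ℚ
total V h F = ∑ (λ v → 𝟙 (member V v) * F (v ⊕ h))

mass-pos : ∀ {m} (V : Subspace m) → Positive (mass V)
mass-pos V = positive (ℚ.<-≤-trans (ℚ.positive⁻¹ 1ℚ)
  (subst (λ b → 𝟙 b ≤ mass V) (∈⇒≡ (0ᵥ∈ V)) (∑-term (𝟙-nonneg ∘ member V) 0ᵥ)))

abstract
  weight : ∀ {m} → Subspace m → ℚ
  weight V = (1/ mass V) {{ℚ.pos⇒nonZero (mass V) {{mass-pos V}}}}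

  weight*mass : ∀ {m} (V : Subspace m) → weight V * mass V ≡ 1ℚ
  weight*mass V = ℚ.*-inverseˡ (mass V) {{ℚ.pos⇒nonZero (mass V) {{mass-pos V}}}}

  weight-nonneg : ∀ {m} (V : Subspace m) → 0ℚ ≤ weight V
  weight-nonneg V = ℚ.<⇒≤ (ℚ.positive⁻¹ (weight V) {{ℚ.1/pos⇒pos (mass V) {{mass-pos V}}}})

𝔼 : ∀ {m} → Subspace m → 𝔽₂^ m → (𝔽₂^ m → ℚ) → ℚ
𝔼 V h F = weight V * total V h F

𝔼-cong : ∀ {m} (V : Subspace m) h {F G} → (∀ x → x ∈ h ⊞ V → F x ≡ G x) → 𝔼 V h F ≡ 𝔼 V h G
𝔼-cong V h {F} {G} eq = cong (weight V *_) (∑-cong pointwise)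
  where
  pointwise : ∀ v → 𝟙 (member V v) * F (v ⊕ h) ≡ 𝟙 (member V v) * G (v ⊕ h)
  pointwise v with member V v in v∈
  ... | true  = cong (1ℚ *_) (eq (v ⊕ h) (∈-respˡ V (sym (⊕-cancelʳ v h)) (≡⇒∈ {V = V} v∈)))
  ... | false = trans (ℚ.*-zeroˡ (F (v ⊕ h))) (sym (ℚ.*-zeroˡ (G (v ⊕ h))))

𝔼-mono : ∀ {m} (V : Subspace m) h {F G} → (∀ x → F x ≤ G x) → 𝔼 V h F ≤ 𝔼 V h G
𝔼-mono V h le = *-monoˡ (weight V) (weight-nonneg V)
  (∑-mono (λ v → *-monoˡ (𝟙 (member V v)) (𝟙-nonneg (member V v)) (le (v ⊕ h))))

𝔼-* : ∀ {m} (V : Subspace m) h c F → 𝔼 V h (λ x → c * F x) ≡ c * 𝔼 V h F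
𝔼-* V h c F = begin
  weight V * ∑ (λ v → 𝟙 (member V v) * (c * F (v ⊕ h)))
    ≡⟨ cong (weight V *_) (trans (∑-cong (λ v → exchange (𝟙 (member V v)) c (F (v ⊕ h))))
                                 (∑-* c (λ v → 𝟙 (member V v) * F (v ⊕ h)))) ⟩
  weight V * (c * total V h F)
    ≡⟨ exchange (weight V) c (total V h F) ⟩
  c * 𝔼 V h F ∎
  where
  open ≡-Reasoning
  exchange : ∀ a b c → a * (b * c) ≡ b * (a * c)
  exchange = solve 3 (λ a b c → a :* (b :* c) := b :* (a :* c)) refl

𝔼-const : ∀ {m} (V : Subspace m) h c → 𝔼 V h (λ _ → c) ≡ c
𝔼-const V h c = begin
  weight V * ∑ (λ v → 𝟙 (member V v) * c) ≡⟨ cong (weight V *_) (∑-cong (λ v → ℚ.*-comm (𝟙 (member V v)) c)) ⟩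
  weight V * ∑ (λ v → c * 𝟙 (member V v)) ≡⟨ cong (weight V *_) (∑-* c (𝟙 ∘ member V)) ⟩
  weight V * (c * mass V)                 ≡⟨ solve 3 (λ w c s → w :* (c :* s) := (w :* s) :* c) refl (weight V) c (mass V) ⟩
  (weight V * mass V) * c                 ≡⟨ cong (_* c) (weight*mass V) ⟩
  1ℚ * c                                  ≡⟨ ℚ.*-identityˡ c ⟩
  c                                       ∎
  where open ≡-Reasoning

𝔼-nonneg : ∀ {m} (V : Subspace m) h {F} → (∀ x → 0ℚ ≤ F x) → 0ℚ ≤ 𝔼 V h F
𝔼-nonneg V h le = ≤-trans (≤-reflexive (sym (𝔼-const V h 0ℚ))) (𝔼-mono V h le)

𝔼-+ : ∀ {m} (V : Subspace m) h F G → 𝔼 V h (λ x → F x + G x) ≡ 𝔼 V h F + 𝔼 V h G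
𝔼-+ V h F G = trans
  (cong (weight V *_) (trans (∑-cong (λ v → ℚ.*-distribˡ-+ (𝟙 (member V v)) (F (v ⊕ h)) (G (v ⊕ h))))
                             (∑-+ (λ v → 𝟙 (member V v) * F (v ⊕ h)) (λ v → 𝟙 (member V v) * G (v ⊕ h)))))
  (ℚ.*-distribˡ-+ (weight V) _ _)

∑-𝔼 : ∀ {m n} (V : Subspace m) h (F : 𝔽₂^ n → 𝔽₂^ m → ℚ) →
      ∑ (λ y → 𝔼 V h (F y)) ≡ 𝔼 V h (λ x → ∑ (λ y → F y x))
∑-𝔼 V h F = begin
  ∑ (λ y → weight V * total V h (F y))   ≡⟨ ∑-* (weight V) (λ y → total V h (F y)) ⟩
  weight V * ∑ (λ y → total V h (F y))   ≡⟨ cong (weight V *_) (∑-swap (λ y v → 𝟙 (member V v) * F y (v ⊕ h))) ⟩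
  weight V * ∑ (λ v → ∑ (λ y → 𝟙 (member V v) * F y (v ⊕ h)))
    ≡⟨ cong (weight V *_) (∑-cong (λ v → ∑-* (𝟙 (member V v)) (λ y → F y (v ⊕ h)))) ⟩
  𝔼 V h (λ x → ∑ (λ y → F y x)) ∎
  where open ≡-Reasoning

-- The points of `V` with `l` equal to 1 form the translate of `V ∩ l` by `v`, so shifting the
-- summation variable by `v` turns their sum into one over `V ∩ l` with base point `h ⊕ v`.
total-split : ∀ {m} (V : Subspace m) l {v} → v ∈ V → dot l v ≡ true → ∀ h F →
              total V h F ≡ total (V ∩ l) h F + total (V ∩ l) (h ⊕ v) F
total-split V l {v} v∈V lv h F = begin
  ∑ (λ u → 𝟙 (member V u) * F (u ⊕ h))
    ≡⟨ ∑-cong (λ u → cases (member V u) (dot l u) (F (u ⊕ h))) ⟩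
  ∑ (λ u → 𝟙 (member V u ∧ not (dot l u)) * F (u ⊕ h) + off u)
    ≡⟨ ∑-+ (λ u → 𝟙 (member V u ∧ not (dot l u)) * F (u ⊕ h)) off ⟩
  total (V ∩ l) h F + ∑ off
    ≡⟨ cong (λ z → total (V ∩ l) h F + z) (sym (∑-shift off v)) ⟩
  total (V ∩ l) h F + ∑ (λ u → off (u ⊕ v))
    ≡⟨ cong (λ z → total (V ∩ l) h F + z) (∑-cong shifted) ⟩
  total (V ∩ l) h F + total (V ∩ l) (h ⊕ v) F ∎
  where
  open ≡-Reasoning
  off : 𝔽₂^ _ → ℚ
  off u = 𝟙 (member V u ∧ dot l u) * F (u ⊕ h)
  cases : ∀ a b q → 𝟙 a * q ≡ 𝟙 (a ∧ not b) * q + 𝟙 (a ∧ b) * q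
  cases false b     q = sym (trans (cong₂ _+_ (ℚ.*-zeroˡ q) (ℚ.*-zeroˡ q)) (sym (ℚ.*-zeroˡ q)))
  cases true  false q = sym (trans (cong (λ z → 1ℚ * q + z) (ℚ.*-zeroˡ q)) (ℚ.+-identityʳ _))
  cases true  true  q = sym (trans (cong (_+ 1ℚ * q) (ℚ.*-zeroˡ q)) (ℚ.+-identityˡ _))
  shifted : ∀ u → off (u ⊕ v) ≡ 𝟙 (member V u ∧ not (dot l u)) * F (u ⊕ (h ⊕ v))
  shifted u = cong₂ (λ b x → 𝟙 b * F x)
    (cong₂ _∧_ (member-shift V v∈V u)
               (trans (dot-⊕ l u v) (trans (cong (dot l u xor_) lv) (Bool.xor-comm (dot l u) true))))
    (trans (⊕-assoc u v h) (cong (u ⊕_) (⊕-comm v h)))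

mass-split : ∀ {m} (V : Subspace m) l {v} → v ∈ V → dot l v ≡ true → mass V ≡ mass (V ∩ l) + mass (V ∩ l)
mass-split V l {v} v∈V lv = trans (as-total V) (trans (total-split V l v∈V lv 0ᵥ (λ _ → 1ℚ))
                                   (sym (cong₂ _+_ (as-total (V ∩ l)) (as-total (V ∩ l)))))
  where
  as-total : ∀ U → mass U ≡ ∑ (λ u → 𝟙 (member U u) * 1ℚ)
  as-total U = ∑-cong (λ u → sym (ℚ.*-identityʳ (𝟙 (member U u))))

weight-split : ∀ {m} (V : Subspace m) l {v} → v ∈ V → dot l v ≡ true → weight V ≡ ½ * weight (V ∩ l)
weight-split V l v∈V lv = begin
  w                          ≡⟨ sym (ℚ.*-identityʳ w) ⟩
  w * 1ℚ                     ≡⟨ cong (w *_) (sym (weight*mass (V ∩ l))) ⟩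
  w * (w' * c')              ≡⟨ solve 3 (λ w w' c' → w :* (w' :* c') := (w :* (c' :+ c')) :* (con ½ :* w')) refl w w' c' ⟩
  (w * (c' + c')) * (½ * w') ≡⟨ cong (λ c → (w * c) * (½ * w')) (sym (mass-split V l v∈V lv)) ⟩
  (w * mass V) * (½ * w')    ≡⟨ cong (_* (½ * w')) (weight*mass V) ⟩
  1ℚ * (½ * w')              ≡⟨ ℚ.*-identityˡ (½ * w') ⟩
  ½ * w'                     ∎
  where
  open ≡-Reasoning
  w = weight V
  w' = weight (V ∩ l)
  c' = mass (V ∩ l)

-- The two cosets of `V ∩ l` inside h + V have equal size. `𝔼-translate`, `𝔼-product` and
-- `affinity-split` condition on one form at a time through this identity.
𝔼-split : ∀ {m} (V : Subspace m) l {v} → v ∈ V → dot l v ≡ true → ∀ h F →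
          𝔼 V h F ≡ ½ * (𝔼 (V ∩ l) h F + 𝔼 (V ∩ l) (h ⊕ v) F)
𝔼-split V l {v} v∈V lv h F = begin
  weight V * total V h F ≡⟨ cong₂ _*_ (weight-split V l v∈V lv) (total-split V l v∈V lv h F) ⟩
  (½ * w) * (a + b)      ≡⟨ solve 3 (λ w a b → (con ½ :* w) :* (a :+ b) := con ½ :* (w :* a :+ w :* b)) refl w a b ⟩
  ½ * (w * a + w * b)    ∎
  where
  open ≡-Reasoning
  w = weight (V ∩ l)
  a = total (V ∩ l) h F
  b = total (V ∩ l) (h ⊕ v) F

-- Independent linear forms and functions determined by them

-- Linear independence of the restrictions to `V`, with witnesses: each form takes the value 1
-- somewhere on the common kernel of its predecessors in `V`.
data Indep {m} (V : Subspace m) : List (𝔽₂^ m) → Set where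
  []    : Indep V []
  step  : ∀ {l L v} → v ∈ V → dot l v ≡ true → Indep (V ∩ l) L → Indep V (l ∷ L)

-- Factoring through the forms in `L`, without naming the outer function. Only differences `x ⊕ y`
-- are tested, so the constant terms of affine forms drop out and coefficient vectors suffice.
record Determined {m} {A : Set} (V : Subspace m) (h : 𝔽₂^ m) (L : List (𝔽₂^ m)) (G : 𝔽₂^ m → A) : Set where
  constructor determined
  field agree : ∀ {x y} → x ∈ h ⊞ V → y ∈ h ⊞ V → (x ⊕ y) ⟂ L → G x ≡ G y

open Determined public

Determined-∘ : ∀ {m} {A B : Set} {V : Subspace m} {h L} {G : 𝔽₂^ m → A} (f : A → B) →
               Determined V h L G → Determined V h L (f ∘ G)
Determined-∘ f det = determined λ x∈ y∈ xy → cong f (agree det x∈ y∈ xy)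

Determined-⊆ : ∀ {m} {A : Set} {V W : Subspace m} {h h' L} {G : 𝔽₂^ m → A} → V ⊆ W → h' ∈ h ⊞ W →
               Determined W h L G → Determined V h' L G
Determined-⊆ {W = W} V⊆W h'∈ det = determined λ x∈ y∈ → agree det (∈⊞-trans W (V⊆W x∈) h'∈) (∈⊞-trans W (V⊆W y∈) h'∈)

dot-difference : ∀ {m} (V : Subspace m) l {h x y} → x ∈ h ⊞ (V ∩ l) → y ∈ h ⊞ (V ∩ l) → dot l (x ⊕ y) ≡ false
dot-difference V l {h} {x} {y} x∈ y∈ = begin
  dot l (x ⊕ y)                   ≡⟨ cong (dot l) (sym (⊕-chain x h y)) ⟩
  dot l ((x ⊕ h) ⊕ (h ⊕ y))       ≡⟨ dot-⊕ l (x ⊕ h) (h ⊕ y) ⟩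
  dot l (x ⊕ h) xor dot l (h ⊕ y) ≡⟨ cong₂ _xor_ (proj₂ (∩-elim V l x∈))
                                       (trans (cong (dot l) (⊕-comm h y)) (proj₂ (∩-elim V l y∈))) ⟩
  false                           ∎
  where open ≡-Reasoning

-- On a coset of `V ∩ l` the form `l` is constant, so it can be struck from the list.
Determined-∩ : ∀ {m} {A : Set} {V : Subspace m} {h h' l L} {G : 𝔽₂^ m → A} → h' ∈ h ⊞ V →
               Determined V h (l ∷ L) G → Determined (V ∩ l) h' L G
Determined-∩ {V = V} {l = l} h'∈ det = determined λ x∈ y∈ xy →
  agree (Determined-⊆ (∩⊆ V l) h'∈ det) x∈ y∈ (dot-difference V l x∈ y∈ ∷ xy)

𝔼-determined[] : ∀ {m} {V : Subspace m} {h G} → Determined V h [] G → 𝔼 V h G ≡ G h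
𝔼-determined[] {V = V} {h} {G} det =
  trans (𝔼-cong V h (λ x x∈ → agree det x∈ (self∈ V h) [])) (𝔼-const V h (G h))

-- The law of G on cosets of V is the same throughout h + W: both averages unfold along L into the
-- same values of G, possibly in a different order.
𝔼-translate : ∀ {m} {V W : Subspace m} {h h' L G} → V ⊆ W → h' ∈ h ⊞ W →
              Determined W h L G → Indep V L → 𝔼 V h G ≡ 𝔼 V h' G
𝔼-translate {V = V} {W} {h} {h'} {[]} {G} V⊆W h'∈ det [] = begin
  𝔼 V h G  ≡⟨ 𝔼-determined[] (Determined-⊆ V⊆W (self∈ W h) det) ⟩
  G h      ≡⟨ agree det (self∈ W h) h'∈ [] ⟩
  G h'     ≡⟨ sym (𝔼-determined[] (Determined-⊆ V⊆W h'∈ det)) ⟩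
  𝔼 V h' G ∎
  where open ≡-Reasoning
𝔼-translate {V = V} {W} {h} {h'} {l ∷ L} {G} V⊆W h'∈ det (step {v = v} v∈ lv ind)
  with dot l (h' ⊕ h) in lh
... | false = begin
  𝔼 V h G                                         ≡⟨ 𝔼-split V l v∈ lv h G ⟩
  ½ * (𝔼 (V ∩ l) h G + 𝔼 (V ∩ l) (h ⊕ v) G)       ≡⟨ cong₂ (λ a b → ½ * (a + b))
     (𝔼-translate (∩-mono {V = V} {W} l V⊆W) (∩-intro W l h'∈ lh) (Determined-∩ (self∈ W h) det) ind)
     (𝔼-translate (∩-mono {V = V} {W} l V⊆W)
        (∈-respˡ (W ∩ l) (sym (trans (cong ((h' ⊕ v) ⊕_) (⊕-comm h v)) (⊕-chain h' v h))) (∩-intro W l h'∈ lh))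
        (Determined-∩ (∈⊞-shift W h (V⊆W v∈)) det) ind) ⟩
  ½ * (𝔼 (V ∩ l) h' G + 𝔼 (V ∩ l) (h' ⊕ v) G)     ≡⟨ sym (𝔼-split V l v∈ lv h' G) ⟩
  𝔼 V h' G                                        ∎
  where open ≡-Reasoning
... | true = begin
  𝔼 V h G                                         ≡⟨ 𝔼-split V l v∈ lv h G ⟩
  ½ * (𝔼 (V ∩ l) h G + 𝔼 (V ∩ l) (h ⊕ v) G)       ≡⟨ cong₂ (λ a b → ½ * (a + b))
     (𝔼-translate (∩-mono {V = V} {W} l V⊆W) (∈-respˡ (W ∩ l) (⊕-swapʳ h' h v) moved)
        (Determined-∩ (self∈ W h) det) ind)
     (𝔼-translate (∩-mono {V = V} {W} l V⊆W) (∈-respˡ (W ∩ l) (⊕-assoc h' h v) moved)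
        (Determined-∩ (∈⊞-shift W h (V⊆W v∈)) det) ind) ⟩
  ½ * (𝔼 (V ∩ l) (h' ⊕ v) G + 𝔼 (V ∩ l) h' G)     ≡⟨ cong (½ *_) (ℚ.+-comm (𝔼 (V ∩ l) (h' ⊕ v) G) _) ⟩
  ½ * (𝔼 (V ∩ l) h' G + 𝔼 (V ∩ l) (h' ⊕ v) G)     ≡⟨ sym (𝔼-split V l v∈ lv h' G) ⟩
  𝔼 V h' G                                        ∎
  where
  open ≡-Reasoning
  moved : (h' ⊕ h) ⊕ v ∈ W ∩ l
  moved = ∩-intro W l (⊕∈ h'∈ (V⊆W v∈)) (trans (dot-⊕ l (h' ⊕ h) v) (cong₂ _xor_ lh lv))

-- Conditioning on the values of all forms in `L` leaves a coset of `V ∩* L`, on which `G` is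
-- constant. A bound on the average of `F` that is uniform over these cosets takes the place of
-- independence.
𝔼-product : ∀ {m} {V : Subspace m} {h L G F c} → (∀ x → 0ℚ ≤ G x) → Determined V h L G → Indep V L →
            (∀ h' → h' ∈ h ⊞ V → 𝔼 (V ∩* L) h' F ≤ c) → 𝔼 V h (λ x → G x * F x) ≤ 𝔼 V h G * c
𝔼-product {V = V} {h} {[]} {G} {F} {c} G≥0 det [] le = begin
  𝔼 V h (λ x → G x * F x) ≡⟨ 𝔼-cong V h (λ x x∈ → cong (_* F x) (agree det x∈ (self∈ V h) [])) ⟩
  𝔼 V h (λ x → G h * F x) ≡⟨ 𝔼-* V h (G h) F ⟩
  G h * 𝔼 V h F           ≤⟨ *-monoˡ (G h) (G≥0 h) (le h (self∈ V h)) ⟩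
  G h * c                 ≡⟨ cong (_* c) (sym (𝔼-determined[] det)) ⟩
  𝔼 V h G * c             ∎
  where open ℚ.≤-Reasoning
𝔼-product {V = V} {h} {l ∷ L} {G} {F} {c} G≥0 det (step {v = v} v∈ lv ind) le = begin
  𝔼 V h GF                                      ≡⟨ 𝔼-split V l v∈ lv h GF ⟩
  ½ * (𝔼 (V ∩ l) h GF + 𝔼 (V ∩ l) (h ⊕ v) GF)   ≤⟨ *-monoˡ ½ ½-nonneg (+-mono-≤
     (𝔼-product {F = F} G≥0 (Determined-∩ (self∈ V h) det) ind (λ h' h'∈ → le h' (∩⊆ V l h'∈)))
     (𝔼-product {F = F} G≥0 (Determined-∩ (∈⊞-shift V h v∈) det) ind
        (λ h' h'∈ → le h' (∈⊞-trans V (∩⊆ V l h'∈) (∈⊞-shift V h v∈))))) ⟩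
  ½ * (𝔼 (V ∩ l) h G * c + 𝔼 (V ∩ l) (h ⊕ v) G * c)
    ≡⟨ solve 3 (λ a b c → con ½ :* (a :* c :+ b :* c) := (con ½ :* (a :+ b)) :* c) refl (𝔼 (V ∩ l) h G) (𝔼 (V ∩ l) (h ⊕ v) G) c ⟩
  ½ * (𝔼 (V ∩ l) h G + 𝔼 (V ∩ l) (h ⊕ v) G) * c ≡⟨ cong (_* c) (sym (𝔼-split V l v∈ lv h G)) ⟩
  𝔼 V h G * c                                   ∎
  where
  open ℚ.≤-Reasoning
  GF : 𝔽₂^ _ → ℚ
  GF x = G x * F x

-- Deciding independence of a list of forms.

search : ∀ {m} (p : 𝔽₂^ m → Bool) → (∃[ x ] p x ≡ true) ⊎ (∀ x → p x ≡ false)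
search {zero} p with p [] in eq
... | true  = inj₁ ([] , eq)
... | false = inj₂ λ { [] → eq }
search {suc m} p with search (p ∘ (false ∷_)) | search (p ∘ (true ∷_))
... | inj₁ (x , eq) | _             = inj₁ (false ∷ x , eq)
... | inj₂ _        | inj₁ (x , eq) = inj₁ (true ∷ x , eq)
... | inj₂ none     | inj₂ none'    = inj₂ λ { (false ∷ x) → none x ; (true ∷ x) → none' x }

nonconstant? : ∀ {m} (V : Subspace m) l → (∃[ v ] v ∈ V × dot l v ≡ true) ⊎ (∀ {v} → v ∈ V → dot l v ≡ false)
nonconstant? V l with search (λ v → member V v ∧ dot l v)
... | inj₁ (v , eq) = inj₁ (v , ≡⇒∈ {V = V} (proj₁ both) , proj₂ both)
  where
  split : ∀ a b → a ∧ b ≡ true → a ≡ true × b ≡ true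
  split true true _ = refl , refl
  both = split (member V v) (dot l v) eq
... | inj₂ none = inj₂ λ {v} v∈ → trans (sym (cong (_∧ dot l v) (∈⇒≡ v∈))) (none v)

-- The first form that vanishes on the common kernel of its predecessors can be deleted: on `V` its
-- vanishing follows from theirs.
indep⊎redundant : ∀ {m} (V : Subspace m) L →
  Indep V L ⊎ (∃[ L' ] suc (length L') ≡ length L × (∀ {v} → v ∈ V → v ⟂ L' → v ⟂ L))
indep⊎redundant V []      = inj₁ []
indep⊎redundant V (l ∷ L) with nonconstant? V l
... | inj₂ const         = inj₂ (L , refl , λ v∈ v⟂L → const v∈ ∷ v⟂L)
... | inj₁ (v , v∈ , lv) with indep⊎redundant (V ∩ l) L
...   | inj₁ ind              = inj₁ (step v∈ lv ind)
...   | inj₂ (L' , len , imp) = inj₂ (l ∷ L' , cong suc len , λ { u∈ (lu ∷ u⟂L') → lu ∷ imp (∩-intro V l u∈ lu) u⟂L' })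

-- Affinity with the product distribution

outcome : ∀ {m n} → (Fin n → 𝔽₂^ m → 𝔽₂) → 𝔽₂^ m → 𝔽₂^ n
outcome P x = Vec.tabulate (λ i → P i x)

prob : ∀ {m n} → Subspace m → 𝔽₂^ m → (Fin n → 𝔽₂^ m → 𝔽₂) → 𝔽₂^ n → ℚ
prob V h P y = 𝔼 V h (λ x → 𝟙 (outcome P x ≡ᵇ y))

bern : ∀ {n} → 𝔽₂^ n → ℚ
bern {n} = Ber ⅓ ⊗^ n

affinity : ∀ {m n} → Subspace m → 𝔽₂^ m → (Fin n → 𝔽₂^ m → 𝔽₂) → ℚ
affinity V h P = ∑ (λ y → prob V h P y ⊓ bern y)

Ber-nonneg : ∀ b → 0ℚ ≤ Ber ⅓ b
Ber-nonneg true  = ℚ.nonNegative⁻¹ (Ber ⅓ true)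
Ber-nonneg false = ℚ.nonNegative⁻¹ (Ber ⅓ false)

bern-nonneg : ∀ {n} (y : 𝔽₂^ n) → 0ℚ ≤ bern y
bern-nonneg []      = ℚ.nonNegative⁻¹ 1ℚ
bern-nonneg (b ∷ y) = *-nonneg (Ber-nonneg b) (bern-nonneg y)

prob-nonneg : ∀ {m n} (V : Subspace m) h (P : Fin n → 𝔽₂^ m → 𝔽₂) y → 0ℚ ≤ prob V h P y
prob-nonneg V h P y = 𝔼-nonneg V h (λ x → 𝟙-nonneg (outcome P x ≡ᵇ y))

-- If `a` or `b` is at least `q`, its own minimum is already `q`; otherwise the minima are `a` and
-- `b`, whose sum is at least their average.
⊓-average : ∀ {a b q} → 0ℚ ≤ a → 0ℚ ≤ b → 0ℚ ≤ q → (½ * (a + b)) ⊓ q ≤ (a ⊓ q) + (b ⊓ q)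
⊓-average {a} {b} {q} 0≤a 0≤b 0≤q with ℚ.≤-total a q | ℚ.≤-total b q
... | inj₂ q≤a | _ = begin
  (½ * (a + b)) ⊓ q   ≤⟨ ℚ.p⊓q≤q (½ * (a + b)) q ⟩
  q                   ≤⟨ ≤-by (b ⊓ q) (ℚ.⊓-glb 0≤b 0≤q) refl ⟩
  q + (b ⊓ q)         ≡⟨ cong (_+ (b ⊓ q)) (sym (ℚ.p≥q⇒p⊓q≡q q≤a)) ⟩
  (a ⊓ q) + (b ⊓ q)   ∎
  where open ℚ.≤-Reasoning
... | inj₁ a≤q | inj₂ q≤b = begin
  (½ * (a + b)) ⊓ q   ≤⟨ ℚ.p⊓q≤q (½ * (a + b)) q ⟩
  q                   ≤⟨ ≤-by (a ⊓ q) (ℚ.⊓-glb 0≤a 0≤q) (ℚ.+-comm q _) ⟩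
  (a ⊓ q) + q         ≡⟨ cong (λ z → (a ⊓ q) + z) (sym (ℚ.p≥q⇒p⊓q≡q q≤b)) ⟩
  (a ⊓ q) + (b ⊓ q)   ∎
  where open ℚ.≤-Reasoning
... | inj₁ a≤q | inj₁ b≤q = begin
  (½ * (a + b)) ⊓ q   ≤⟨ ℚ.p⊓q≤p (½ * (a + b)) q ⟩
  ½ * (a + b)         ≤⟨ ≤-by (½ * (a + b)) (*-nonneg ½-nonneg (+-nonneg 0≤a 0≤b))
                           (solve 1 (λ s → con ½ :* s :+ con ½ :* s := s) refl (a + b)) ⟩
  a + b               ≡⟨ cong₂ _+_ (sym (ℚ.p≤q⇒p⊓q≡p a≤q)) (sym (ℚ.p≤q⇒p⊓q≡p b≤q)) ⟩
  (a ⊓ q) + (b ⊓ q)   ∎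
  where open ℚ.≤-Reasoning

affinity-split : ∀ {m n} (V : Subspace m) l {v} → v ∈ V → dot l v ≡ true → ∀ h (P : Fin n → 𝔽₂^ m → 𝔽₂) →
                affinity V h P ≤ affinity (V ∩ l) h P + affinity (V ∩ l) (h ⊕ v) P
affinity-split V l {v} v∈ lv h P = begin
  ∑ (λ y → prob V h P y ⊓ bern y)
    ≡⟨ ∑-cong (λ y → cong (_⊓ bern y) (𝔼-split V l v∈ lv h (λ x → 𝟙 (outcome P x ≡ᵇ y)))) ⟩
  ∑ (λ y → (½ * (p y + p' y)) ⊓ bern y)
    ≤⟨ ∑-mono (λ y → ⊓-average (prob-nonneg (V ∩ l) h P y) (prob-nonneg (V ∩ l) (h ⊕ v) P y) (bern-nonneg y)) ⟩
  ∑ (λ y → (p y ⊓ bern y) + (p' y ⊓ bern y))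
    ≡⟨ ∑-+ (λ y → p y ⊓ bern y) (λ y → p' y ⊓ bern y) ⟩
  affinity (V ∩ l) h P + affinity (V ∩ l) (h ⊕ v) P ∎
  where
  open ℚ.≤-Reasoning
  p p' : 𝔽₂^ _ → ℚ
  p  = prob (V ∩ l) h P
  p' = prob (V ∩ l) (h ⊕ v) P

-- There are 2^|L| cosets. Their affinities are added and not averaged, since each is taken against
-- the whole of `bern`.
affinity-mixture : ∀ {m n} {V : Subspace m} {L} → Indep V L → ∀ h (P : Fin n → 𝔽₂^ m → 𝔽₂) {B} →
  (∀ h' → h' ∈ h ⊞ V → affinity (V ∩* L) h' P ≤ B) → affinity V h P ≤ 2ℚ ^ length L * B
affinity-mixture {V = V} [] h P {B} le = ≤-trans (le h (self∈ V h)) (≤-reflexive (sym (ℚ.*-identityˡ B)))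
affinity-mixture {V = V} {l ∷ L} (step {v = v} v∈ lv ind) h P {B} le = begin
  affinity V h P
    ≤⟨ affinity-split V l v∈ lv h P ⟩
  affinity (V ∩ l) h P + affinity (V ∩ l) (h ⊕ v) P
    ≤⟨ +-mono-≤ (affinity-mixture ind h P (λ h' h'∈ → le h' (∩⊆ V l h'∈)))
                (affinity-mixture ind (h ⊕ v) P (λ h' h'∈ → le h' (∈⊞-trans V (∩⊆ V l h'∈) (∈⊞-shift V h v∈)))) ⟩
  2ℚ ^ length L * B + 2ℚ ^ length L * B
    ≡⟨ solve 2 (λ c B → c :* B :+ c :* B := ((con 1ℚ :+ con 1ℚ) :* c) :* B) refl (2ℚ ^ length L) B ⟩
  2ℚ ^ suc (length L) * B ∎
  where open ℚ.≤-Reasoning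

∩*⊆ : ∀ {m} (V : Subspace m) L → V ∩* L ⊆ V
∩*⊆ V L v∈ = proj₁ (∩*-elim V L v∈)

-- Exponential tests separating Ber(μ) from Ber(1/3)

-- `t-mean` bounds the mean of `t` under Ber(μ), written as an affine function of `μ`; `u` plays the
-- part of 1/t under Ber(1/3). The factors `ρ` multiply over the coordinates.
record Test (ρ μ : ℚ) : Set where
  field
    t u      : 𝔽₂ → ℚ
    t-nonneg : ∀ b → 0ℚ ≤ t b
    u-nonneg : ∀ b → 0ℚ ≤ u b
    1≤tu     : ∀ b → 1ℚ ≤ t b * u b
    t-mean   : t false + (t true - t false) * μ ≤ ρ
    u-mean   : Ber ⅓ false * u false + Ber ⅓ true * u true ≤ ρ

𝔼-bit : ∀ {m} (V : Subspace m) h (f : 𝔽₂ → ℚ) (G : 𝔽₂^ m → 𝔽₂) →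
        𝔼 V h (f ∘ G) ≡ f false + (f true - f false) * 𝔼 V h (𝟙 ∘ G)
𝔼-bit V h f G = begin
  𝔼 V h (f ∘ G)
    ≡⟨ 𝔼-cong V h (λ x _ → interpolate (G x)) ⟩
  𝔼 V h (λ x → f false + (f true - f false) * 𝟙 (G x))
    ≡⟨ 𝔼-+ V h (λ _ → f false) (λ x → (f true - f false) * 𝟙 (G x)) ⟩
  𝔼 V h (λ _ → f false) + 𝔼 V h (λ x → (f true - f false) * 𝟙 (G x))
    ≡⟨ cong₂ _+_ (𝔼-const V h (f false)) (𝔼-* V h (f true - f false) (𝟙 ∘ G)) ⟩
  f false + (f true - f false) * 𝔼 V h (𝟙 ∘ G) ∎
  where
  open ≡-Reasoning
  interpolate : ∀ b → f b ≡ f false + (f true - f false) * 𝟙 b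
  interpolate false = solve 2 (λ a b → b := b :+ (a :- b) :* con 0ℚ) refl (f true) (f false)
  interpolate true  = solve 2 (λ a b → a := b :+ (a :- b) :* con 1ℚ) refl (f true) (f false)

-- The greedy choice

-- A scan of the functions in order: `V` is the common kernel of the forms fixed so far, `U` the
-- final one, `k` the number of picks. A pick stores a test for the law on h₀ + V alone, since
-- `𝔼-translate` carries it to the other cosets; a skip stores one shortened list of forms that
-- serves every coset of `V` in h₀ + V₀.
data Greedy {m} (ρ : ℚ) (r : ℕ) (V₀ : Subspace m) (h₀ : 𝔽₂^ m) :
            ∀ {n} → Subspace m → (Fin n → 𝔽₂^ m → 𝔽₂) → ℕ → Subspace m → Set where
  done : ∀ {V} {P : Fin 0 → 𝔽₂^ m → 𝔽₂} → Greedy ρ r V₀ h₀ V P 0 V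
  pick : ∀ {n V k U L} {P : Fin (suc n) → 𝔽₂^ m → 𝔽₂} →
         length L ℕ.≤ r → Determined V₀ h₀ L (P zero) → Indep V L → Test ρ (𝔼 V h₀ (𝟙 ∘ P zero)) →
         Greedy ρ r V₀ h₀ (V ∩* L) (P ∘ suc) k U → Greedy ρ r V₀ h₀ V P (suc k) U
  skip : ∀ {n V k U L} {P : Fin (suc n) → 𝔽₂^ m → 𝔽₂} →
         length L ℕ.< r → (∀ {h} → h ∈ h₀ ⊞ V₀ → Determined V h L (P zero)) →
         Greedy ρ r V₀ h₀ V (P ∘ suc) k U → Greedy ρ r V₀ h₀ V P k U

module _ {m} {ρ : ℚ} {r : ℕ} {V₀ : Subspace m} {h₀ : 𝔽₂^ m} where

  -- `indep⊎redundant` decides each function. In the dependent case the deleted form is implied on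
  -- `V` by the others, so these, fewer than `r`, still determine the function on cosets of `V`.
  greedy : ∀ {n} {V} (P : Fin n → 𝔽₂^ m → 𝔽₂) → V ⊆ V₀ →
           (∀ i → ∃[ L ] length L ℕ.≤ r × Determined V₀ h₀ L (P i)) →
           (∀ i U → U ⊆ V₀ → Test ρ (𝔼 U h₀ (𝟙 ∘ P i))) →
           ∃[ k ] ∃[ U ] Greedy ρ r V₀ h₀ V P k U
  greedy {zero}  {V} P V⊆ forms test = 0 , V , done
  greedy {suc n} {V} P V⊆ forms test with forms zero
  ... | L , len , det with indep⊎redundant V L
  ...   | inj₁ ind with greedy (P ∘ suc) (λ v∈ → V⊆ (∩*⊆ V L v∈)) (forms ∘ suc) (test ∘ suc)
  ...     | k , U , g = suc k , U , pick len det ind (test zero V V⊆) g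
  greedy {suc n} {V} P V⊆ forms test | L , len , det | inj₂ (L' , len' , imp)
    with greedy (P ∘ suc) V⊆ (forms ∘ suc) (test ∘ suc)
  ...     | k , U , g = k , U , skip (subst (ℕ._≤ r) (sym len') len) det' g
    where
    det' : ∀ {h} → h ∈ h₀ ⊞ V₀ → Determined V h L' (P zero)
    det' h∈ = determined λ {x} {y} x∈ y∈ xy → agree (Determined-⊆ V⊆ h∈ det) x∈ y∈
      (imp (∈-respˡ V (trans (cong ((x ⊕ _) ⊕_) (⊕-comm y _)) (⊕-chain x _ y)) (⊕∈ x∈ y∈)) xy)

  greedy-⊆ : ∀ {n V k U} {P : Fin n → 𝔽₂^ m → 𝔽₂} → Greedy ρ r V₀ h₀ V P k U → U ⊆ V
  greedy-⊆ done                                u∈ = u∈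
  greedy-⊆ {V = V} (pick {L = L} _ _ _ _ g) u∈ = ∩*⊆ V L (greedy-⊆ g u∈)
  greedy-⊆ (skip _ _ g)                        u∈ = greedy-⊆ g u∈

  -- Each pick fixes at most `r` forms and so costs a factor of at most `2ℚ ^ r`; a skip fixes
  -- nothing.
  greedy-mixture : ∀ {n V k U} {P : Fin n → 𝔽₂^ m → 𝔽₂} → V ⊆ V₀ → Greedy ρ r V₀ h₀ V P k U →
    ∀ {n'} (Q : Fin n' → 𝔽₂^ m → 𝔽₂) {B} → 0ℚ ≤ B →
    (∀ {h} → h ∈ h₀ ⊞ V₀ → affinity U h Q ≤ B) →
    ∀ {h} → h ∈ h₀ ⊞ V₀ → affinity V h Q ≤ (2ℚ ^ r) ^ k * B
  greedy-mixture V⊆ done Q {B} 0≤B le h∈ = ≤-trans (le h∈) (≤-reflexive (sym (ℚ.*-identityˡ B)))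
  greedy-mixture V⊆ (skip _ _ g) Q 0≤B le h∈ = greedy-mixture V⊆ g Q 0≤B le h∈
  greedy-mixture {V = V} V⊆ (pick {k = k} {L = L} len _ ind _ g) Q {B} 0≤B le {h} h∈ = begin
    affinity V h Q
      ≤⟨ affinity-mixture ind h Q (λ h' h'∈ →
           greedy-mixture (λ v∈ → V⊆ (∩*⊆ V L v∈)) g Q 0≤B le (∈⊞-trans V₀ (V⊆ h'∈) h∈)) ⟩
    2ℚ ^ length L * ((2ℚ ^ r) ^ k * B)
      ≤⟨ *-mono (^-nonneg 2-nonneg (length L)) (*-nonneg (^-nonneg (^-nonneg 2-nonneg r) k) 0≤B) (2^-mono len) ≤-refl ⟩
    2ℚ ^ r * ((2ℚ ^ r) ^ k * B)
      ≡⟨ sym (ℚ.*-assoc (2ℚ ^ r) ((2ℚ ^ r) ^ k) B) ⟩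
    (2ℚ ^ r) ^ suc k * B ∎
    where open ℚ.≤-Reasoning

  -- The product weights of the scan. `τ-mean` ranges over all base points in h₀ + V₀ because fixing
  -- the forms of an earlier pick may lead to any coset of the smaller subspace.
  record Certificate {n} (V : Subspace m) (P : Fin n → 𝔽₂^ m → 𝔽₂) (k : ℕ) : Set where
    field
      τ υ      : 𝔽₂^ n → ℚ
      τ-nonneg : ∀ y → 0ℚ ≤ τ y
      υ-nonneg : ∀ y → 0ℚ ≤ υ y
      1≤τυ     : ∀ y → 1ℚ ≤ τ y * υ y
      τ-mean   : ∀ {h} → h ∈ h₀ ⊞ V₀ → 𝔼 V h (τ ∘ outcome P) ≤ ρ ^ k
      υ-mean   : ∑ (λ y → bern y * υ y) ≤ ρ ^ k

  -- A skipped coordinate receives weight 1, a picked one its test. The means of `υ` multiply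
  -- because `bern` is a product, those of `τ` by `𝔼-product`.
  certificate : 0ℚ ≤ ρ → ∀ {n V k U} {P : Fin n → 𝔽₂^ m → 𝔽₂} → V ⊆ V₀ →
                Greedy ρ r V₀ h₀ V P k U → Certificate V P k
  certificate 0≤ρ {V = V} V⊆ done = record
    { τ = λ _ → 1ℚ ; υ = λ _ → 1ℚ
    ; τ-nonneg = λ _ → ℚ.nonNegative⁻¹ 1ℚ ; υ-nonneg = λ _ → ℚ.nonNegative⁻¹ 1ℚ
    ; 1≤τυ = λ _ → ≤-refl
    ; τ-mean = λ {h} _ → ≤-reflexive (𝔼-const V h 1ℚ)
    ; υ-mean = ≤-refl
    }
  certificate 0≤ρ V⊆ (skip _ _ g) = record
    { τ = λ { (_ ∷ y) → C.τ y } ; υ = λ { (_ ∷ y) → C.υ y }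
    ; τ-nonneg = λ { (_ ∷ y) → C.τ-nonneg y } ; υ-nonneg = λ { (_ ∷ y) → C.υ-nonneg y }
    ; 1≤τυ = λ { (_ ∷ y) → C.1≤τυ y }
    ; τ-mean = C.τ-mean
    -- The two values of the skipped coordinate have total mass 1 under Ber(1/3).
    ; υ-mean = ≤-trans (≤-reflexive (trans
        (cong₂ _+_ (scale (Ber ⅓ false)) (scale (Ber ⅓ true)))
        (trans (sym (ℚ.*-distribʳ-+ Σ (Ber ⅓ false) (Ber ⅓ true))) (ℚ.*-identityˡ Σ)))) C.υ-mean
    }
    where
    module C = Certificate (certificate 0≤ρ V⊆ g)
    Σ = ∑ (λ y → bern y * C.υ y)
    scale : ∀ c → ∑ (λ y → c * bern y * C.υ y) ≡ c * Σ
    scale c = trans (∑-cong (λ y → ℚ.*-assoc c (bern y) (C.υ y))) (∑-* c (λ y → bern y * C.υ y))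
  certificate 0≤ρ {V = V} V⊆ (pick {k = k} {L = L} {P = P} _ det ind test g) = record
    { τ = λ { (b ∷ y) → t b * C.τ y } ; υ = λ { (b ∷ y) → u b * C.υ y }
    ; τ-nonneg = λ { (b ∷ y) → *-nonneg (t-nonneg b) (C.τ-nonneg y) }
    ; υ-nonneg = λ { (b ∷ y) → *-nonneg (u-nonneg b) (C.υ-nonneg y) }
    ; 1≤τυ = λ { (b ∷ y) → ≤-trans
        (*-mono {1ℚ} {t b * u b} {1ℚ} (ℚ.nonNegative⁻¹ 1ℚ) (*-nonneg (C.τ-nonneg y) (C.υ-nonneg y)) (1≤tu b) (C.1≤τυ y))
        (≤-reflexive (interchange (t b) (u b) (C.τ y) (C.υ y))) }
    ; τ-mean = τ-mean
    ; υ-mean = begin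
        ∑ (λ y → Ber ⅓ false * bern y * (u false * C.υ y)) + ∑ (λ y → Ber ⅓ true * bern y * (u true * C.υ y))
          ≡⟨ cong₂ _+_ (scale (Ber ⅓ false) (u false)) (scale (Ber ⅓ true) (u true)) ⟩
        Ber ⅓ false * u false * Σ + Ber ⅓ true * u true * Σ
          ≡⟨ sym (ℚ.*-distribʳ-+ Σ (Ber ⅓ false * u false) (Ber ⅓ true * u true)) ⟩
        (Ber ⅓ false * u false + Ber ⅓ true * u true) * Σ
          ≤⟨ *-mono (+-nonneg (*-nonneg (Ber-nonneg false) (u-nonneg false)) (*-nonneg (Ber-nonneg true) (u-nonneg true)))
                    (≤-trans Σ-nonneg C.υ-mean) u-mean C.υ-mean ⟩
        ρ * ρ ^ k ∎
    }
    where
    open ℚ.≤-Reasoning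
    open Test test
    module C = Certificate (certificate 0≤ρ (λ v∈ → V⊆ (∩*⊆ V L v∈)) g)
    Σ = ∑ (λ y → bern y * C.υ y)
    Σ-nonneg : 0ℚ ≤ Σ
    Σ-nonneg = ∑-nonneg (λ y → *-nonneg (bern-nonneg y) (C.υ-nonneg y))
    interchange : ∀ a b c d → (a * b) * (c * d) ≡ (a * c) * (b * d)
    interchange = solve 4 (λ a b c d → (a :* b) :* (c :* d) := (a :* c) :* (b :* d)) refl
    scale : ∀ c d → ∑ (λ y → c * bern y * (d * C.υ y)) ≡ c * d * Σ
    scale c d = trans (∑-cong (λ y → interchange c (bern y) d (C.υ y))) (∑-* (c * d) (λ y → bern y * C.υ y))
    τ-mean : ∀ {h} → h ∈ h₀ ⊞ V₀ → 𝔼 V h (λ x → t (P zero x) * C.τ (outcome (P ∘ suc) x)) ≤ ρ * ρ ^ k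
    τ-mean {h} h∈ = begin
      𝔼 V h (λ x → t (P zero x) * C.τ (outcome (P ∘ suc) x))
        ≤⟨ 𝔼-product {F = C.τ ∘ outcome (P ∘ suc)} (t-nonneg ∘ P zero)
             (Determined-∘ t (Determined-⊆ V⊆ h∈ det)) ind
             (λ h' h'∈ → C.τ-mean (∈⊞-trans V₀ (V⊆ h'∈) h∈)) ⟩
      𝔼 V h (t ∘ P zero) * ρ ^ k
        -- The stored test speaks of the base point `h₀`; the law of `P zero` is the same at `h`.
        ≡⟨ cong (_* ρ ^ k) (trans (sym (𝔼-translate V⊆ h∈ (Determined-∘ t det) ind)) (𝔼-bit V h₀ t (P zero))) ⟩
      (t false + (t true - t false) * 𝔼 V h₀ (𝟙 ∘ P zero)) * ρ ^ k
        ≤⟨ ℚ.*-monoʳ-≤-nonNeg (ρ ^ k) {{nonNegative (≤-trans Σ-nonneg C.υ-mean)}} t-mean ⟩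
      ρ * ρ ^ k ∎

  -- On a coset of `U` a picked function is constant, all its forms being fixed, and a skipped one
  -- keeps its list of fewer than `r` forms.
  greedy-rank : ∀ {n V k U} {P : Fin n → 𝔽₂^ m → 𝔽₂} → V ⊆ V₀ → Greedy ρ r V₀ h₀ V P k U →
    ∀ {h} → h ∈ h₀ ⊞ V₀ → ∀ i → ∃[ L ] length L ℕ.≤ ℕ.pred r × Determined U h L (P i)
  greedy-rank {U = U} V⊆ (pick {V = V} {L = L} {P = P} _ det _ _ g) {h} h∈ zero = [] , ℕ.z≤n ,
    determined λ {x} {y} x∈ y∈ _ → agree (Determined-⊆ U⊆V₀ h∈ det) x∈ y∈
      (proj₂ (∩*-elim V L (greedy-⊆ g (∈-respˡ U (trans (cong ((x ⊕ h) ⊕_) (⊕-comm y h)) (⊕-chain x h y)) (⊕∈ x∈ y∈)))))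
    where
    U⊆V₀ : U ⊆ V₀
    U⊆V₀ u∈ = V⊆ (∩*⊆ V L (greedy-⊆ g u∈))
  greedy-rank V⊆ (pick {V = V} {L = L} _ _ _ _ g) h∈ (suc i) = greedy-rank (λ v∈ → V⊆ (∩*⊆ V L v∈)) g h∈ i
  greedy-rank {V = V} V⊆ (skip {L = L} len det g) {h} h∈ zero =
    L , ℕ.suc[m]≤n⇒m≤pred[n] len , Determined-⊆ (greedy-⊆ g) (self∈ V h) (det h∈)
  greedy-rank V⊆ (skip _ _ g) h∈ (suc i) = greedy-rank V⊆ g h∈ i

-- From weights to a bound on the affinity.

-- Either `a` is at least 1 and the first term dominates `p`, or `b` is and the second dominates
-- `q`.
⊓≤test : ∀ {p q a b} → 0ℚ ≤ p → 0ℚ ≤ q → 0ℚ ≤ a → 0ℚ ≤ b → 1ℚ ≤ a * b → p ⊓ q ≤ a * p + q * b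
⊓≤test {p} {q} {a} {b} 0≤p 0≤q 0≤a 0≤b 1≤ab with ℚ.≤-total 1ℚ a
... | inj₁ 1≤a = begin
  p ⊓ q         ≤⟨ ℚ.p⊓q≤p p q ⟩
  p             ≡⟨ sym (ℚ.*-identityˡ p) ⟩
  1ℚ * p        ≤⟨ *-mono {1ℚ} (ℚ.nonNegative⁻¹ 1ℚ) 0≤p 1≤a (≤-refl {p}) ⟩
  a * p         ≤⟨ ≤-by (q * b) (*-nonneg 0≤q 0≤b) refl ⟩
  a * p + q * b ∎
  where open ℚ.≤-Reasoning
... | inj₂ a≤1 = begin
  p ⊓ q         ≤⟨ ℚ.p⊓q≤q p q ⟩
  q             ≡⟨ sym (ℚ.*-identityʳ q) ⟩
  q * 1ℚ        ≤⟨ *-monoˡ q 0≤q (≤-trans 1≤ab (≤-trans (*-mono {q = 1ℚ} 0≤a 0≤b a≤1 (≤-refl {b})) (≤-reflexive (ℚ.*-identityˡ b)))) ⟩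
  q * b         ≤⟨ ≤-by (a * p) (*-nonneg 0≤a 0≤p) (ℚ.+-comm (q * b) (a * p)) ⟩
  a * p + q * b ∎
  where open ℚ.≤-Reasoning

∑-prob : ∀ {m n} (V : Subspace m) h (P : Fin n → 𝔽₂^ m → 𝔽₂) (τ : 𝔽₂^ n → ℚ) →
         ∑ (λ y → τ y * prob V h P y) ≡ 𝔼 V h (τ ∘ outcome P)
∑-prob V h P τ = begin
  ∑ (λ y → τ y * prob V h P y)
    ≡⟨ ∑-cong (λ y → sym (𝔼-* V h (τ y) (λ x → 𝟙 (outcome P x ≡ᵇ y)))) ⟩
  ∑ (λ y → 𝔼 V h (λ x → τ y * 𝟙 (outcome P x ≡ᵇ y)))
    ≡⟨ ∑-𝔼 V h (λ y x → τ y * 𝟙 (outcome P x ≡ᵇ y)) ⟩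
  𝔼 V h (λ x → ∑ (λ y → τ y * 𝟙 (outcome P x ≡ᵇ y)))
    ≡⟨ 𝔼-cong V h (λ x _ → trans (∑-cong (λ y → ℚ.*-comm (τ y) (𝟙 (outcome P x ≡ᵇ y)))) (∑-point (outcome P x) τ)) ⟩
  𝔼 V h (τ ∘ outcome P) ∎
  where open ≡-Reasoning

affinity-certificate : ∀ {m n ρ r k} {V : Subspace m} {h} {P : Fin n → 𝔽₂^ m → 𝔽₂} →
                       Certificate {ρ = ρ} {r} {V} {h} V P k → affinity V h P ≤ ρ ^ k + ρ ^ k
affinity-certificate {ρ = ρ} {k = k} {V} {h} {P} cert = begin
  ∑ (λ y → prob V h P y ⊓ bern y)
    ≤⟨ ∑-mono (λ y → ⊓≤test (prob-nonneg V h P y) (bern-nonneg y) (τ-nonneg y) (υ-nonneg y) (1≤τυ y)) ⟩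
  ∑ (λ y → τ y * prob V h P y + bern y * υ y)
    ≡⟨ ∑-+ (λ y → τ y * prob V h P y) (λ y → bern y * υ y) ⟩
  ∑ (λ y → τ y * prob V h P y) + ∑ (λ y → bern y * υ y)
    ≡⟨ cong (_+ ∑ (λ y → bern y * υ y)) (∑-prob V h P τ) ⟩
  𝔼 V h (τ ∘ outcome P) + ∑ (λ y → bern y * υ y)
    ≤⟨ +-mono-≤ (τ-mean (self∈ V h)) υ-mean ⟩
  ρ ^ k + ρ ^ k ∎
  where
  open ℚ.≤-Reasoning
  open Certificate cert

∑-bern : ∀ n → ∑ {n} bern ≡ 1ℚ
∑-bern zero    = refl
∑-bern (suc n) = begin
  ∑ {n} (λ y → Ber ⅓ false * bern y) + ∑ {n} (λ y → Ber ⅓ true * bern y)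
    ≡⟨ cong₂ _+_ (∑-* (Ber ⅓ false) (bern {n})) (∑-* (Ber ⅓ true) (bern {n})) ⟩
  Ber ⅓ false * ∑ {n} bern + Ber ⅓ true * ∑ {n} bern
    ≡⟨ cong (λ s → Ber ⅓ false * s + Ber ⅓ true * s) (∑-bern n) ⟩
  1ℚ ∎
  where open ≡-Reasoning

affinity≤1 : ∀ {m n} (V : Subspace m) h (P : Fin n → 𝔽₂^ m → 𝔽₂) → affinity V h P ≤ 1ℚ
affinity≤1 {n = n} V h P = ≤-trans (∑-mono (λ y → ℚ.p⊓q≤q (prob V h P y) (bern y))) (≤-reflexive (∑-bern n))

-- Explicit tests

1≤-by : ∀ {p} d → 0ℚ ≤ d → 1ℚ + d ≡ p → 1ℚ ≤ p
1≤-by = ≤-by {1ℚ}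

-- Here `u` is 1/t. The large weight 10 sits on the value that never occurs, so the mean of `t` is
-- 9/10; Ber(1/3) gives `b` mass at most 2/3, so the mean of `u` is at most 2/3 · 10/9 + 1/3 · 1/10,
-- below 9/10.
deterministic-test : ∀ b → Test (+ 9 / 10) (𝟙 b)
deterministic-test b = record
  { t = t b ; u = u b
  ; t-nonneg = t-nonneg b ; u-nonneg = u-nonneg b ; 1≤tu = 1≤tu b ; t-mean = t-mean b ; u-mean = u-mean b }
  where
  t u : 𝔽₂ → 𝔽₂ → ℚ
  t false false = + 9 / 10
  t false true  = + 10 / 1
  t true  false = + 10 / 1
  t true  true  = + 9 / 10
  u false false = + 10 / 9
  u false true  = + 1 / 10
  u true  false = + 1 / 10
  u true  true  = + 10 / 9
  t-nonneg : ∀ b c → 0ℚ ≤ t b c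
  t-nonneg false false = toWitness {a? = _ ℚ.≤? _} _
  t-nonneg false true  = toWitness {a? = _ ℚ.≤? _} _
  t-nonneg true  false = toWitness {a? = _ ℚ.≤? _} _
  t-nonneg true  true  = toWitness {a? = _ ℚ.≤? _} _
  u-nonneg : ∀ b c → 0ℚ ≤ u b c
  u-nonneg false false = toWitness {a? = _ ℚ.≤? _} _
  u-nonneg false true  = toWitness {a? = _ ℚ.≤? _} _
  u-nonneg true  false = toWitness {a? = _ ℚ.≤? _} _
  u-nonneg true  true  = toWitness {a? = _ ℚ.≤? _} _
  1≤tu : ∀ b c → 1ℚ ≤ t b c * u b c
  1≤tu false false = toWitness {a? = _ ℚ.≤? _} _
  1≤tu false true  = toWitness {a? = _ ℚ.≤? _} _
  1≤tu true  false = toWitness {a? = _ ℚ.≤? _} _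
  1≤tu true  true  = toWitness {a? = _ ℚ.≤? _} _
  t-mean : ∀ b → t b false + (t b true - t b false) * 𝟙 b ≤ + 9 / 10
  t-mean false = toWitness {a? = _ ℚ.≤? _} _
  t-mean true  = toWitness {a? = _ ℚ.≤? _} _
  u-mean : ∀ b → Ber ⅓ false * u b false + Ber ⅓ true * u b true ≤ + 9 / 10
  u-mean false = toWitness {a? = _ ℚ.≤? _} _
  u-mean true  = toWitness {a? = _ ℚ.≤? _} _

-- Up to second order in e, the test t is the square root of the likelihood ratio of Ber(1/3) and
-- Ber(1/3 ± 10e), and u ≥ 1/t is the expansion of 1/t. The means of t and u are then
-- 1 − Ω(e²) and 1 + O(e²); the factor σ ≈ 1 + 10e² (with inverse at most ς) balances them so that
-- both fall below 1 − 5e².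
module Tests (e : ℚ) (0≤e : 0ℚ ≤ e) (e≤ : e ≤ + 1 / 10) where

  ρ w gap σ ς : ℚ
  w   = e * e
  ρ   = 1ℚ - + 5 / 1 * w
  gap = + 1 / 10 - e
  σ   = 1ℚ + + 10 / 1 * w
  ς   = 1ℚ + (+ 100 / 1 * (w * w) - + 10 / 1 * w)

  private
    0≤ : ∀ p → {{NonNegative p}} → 0ℚ ≤ p
    0≤ p = ℚ.nonNegative⁻¹ p

    0≤gap : 0ℚ ≤ gap
    0≤gap = p-q≥0 e≤

    0≤w : 0ℚ ≤ w
    0≤w = *-nonneg 0≤e 0≤e

    w≤ : w ≤ + 1 / 100
    w≤ = *-mono {q = + 1 / 10} {s = + 1 / 10} 0≤e (0≤ (+ 1 / 10)) e≤ e≤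

    0≤gapʷ : 0ℚ ≤ + 1 / 100 - w
    0≤gapʷ = p-q≥0 w≤

    0≤σ : 0ℚ ≤ σ
    0≤σ = +-nonneg (0≤ 1ℚ) (*-nonneg (0≤ (+ 10 / 1)) 0≤w)

    0≤ς : 0ℚ ≤ ς
    0≤ς = ≤-by (+ 9 / 10 + (+ 100 / 1 * (w * w) + + 10 / 1 * (+ 1 / 100 - w)))
      (+-nonneg (0≤ (+ 9 / 10)) (+-nonneg (*-nonneg (0≤ (+ 100 / 1)) (*-nonneg 0≤w 0≤w)) (*-nonneg (0≤ (+ 10 / 1)) 0≤gapʷ)))
      (solve 1 (λ w → con 0ℚ :+ (con (+ 9 / 10) :+ (con (+ 100 / 1) :* (w :* w) :+ con (+ 10 / 1) :* (con (+ 1 / 100) :- w)))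
                   := con 1ℚ :+ (con (+ 100 / 1) :* (w :* w) :- con (+ 10 / 1) :* w)) refl w)

    -- `ς` is the geometric series of 1/σ up to second order in `w`, so the product is 1 + (10w)³.
    1≤σς : 1ℚ ≤ σ * ς
    1≤σς = 1≤-by (+ 1000 / 1 * (w * (w * w))) (*-nonneg (0≤ (+ 1000 / 1)) (*-nonneg 0≤w (*-nonneg 0≤w 0≤w)))
      (solve 1 (λ w → con 1ℚ :+ con (+ 1000 / 1) :* (w :* (w :* w))
         := (con 1ℚ :+ con (+ 10 / 1) :* w) :* (con 1ℚ :+ (con (+ 100 / 1) :* (w :* w) :- con (+ 10 / 1) :* w))) refl w)

    scaled : ∀ a b → 1ℚ ≤ a * b → 1ℚ ≤ (a * σ) * (b * ς)
    scaled a b 1≤ab = ≤-trans (*-mono {1ℚ} {r = 1ℚ} (0≤ 1ℚ) (*-nonneg 0≤σ 0≤ς) 1≤ab 1≤σς)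
      (≤-reflexive (solve 4 (λ a b s t → (a :* b) :* (s :* t) := (a :* s) :* (b :* t)) refl a b σ ς))

    υ-bound : (1ℚ + + 10 / 3 * w) * ς ≤ ρ
    -- The slack 5/3 · w(1 - 40w - 200w²), regrouped into terms that w ≤ 1/100 makes nonnegative.
    υ-bound = ≤-by (+ 5 / 3 * w * (+ 29 / 50 + (+ 42 / 1 * (+ 1 / 100 - w) + + 200 / 1 * (w * (+ 1 / 100 - w)))))
      (*-nonneg (*-nonneg (0≤ (+ 5 / 3)) 0≤w) (+-nonneg (0≤ (+ 29 / 50))
        (+-nonneg (*-nonneg (0≤ (+ 42 / 1)) 0≤gapʷ) (*-nonneg (0≤ (+ 200 / 1)) (*-nonneg 0≤w 0≤gapʷ)))))
      (solve 1 (λ w → (con 1ℚ :+ con (+ 10 / 3) :* w) :* (con 1ℚ :+ (con (+ 100 / 1) :* (w :* w) :- con (+ 10 / 1) :* w))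
           :+ con (+ 5 / 3) :* w :* (con (+ 29 / 50) :+ (con (+ 42 / 1) :* (con (+ 1 / 100) :- w) :+ con (+ 200 / 1) :* (w :* (con (+ 1 / 100) :- w))))
         := con 1ℚ :- con (+ 5 / 1) :* w) refl w)

    τ-bound : ∀ d → + 10 / 1 * e ≤ d → (1ℚ - + 3 / 1 * (e * d)) * σ ≤ ρ
    -- The worst case d = 10e gives 1 - 20w - 300w², with 15w + 300w² to spare; the last summand
    -- accounts for larger `d`.
    τ-bound d far = ≤-by (+ 15 / 1 * w + + 300 / 1 * (w * w) + σ * (+ 3 / 1 * (e * (d - + 10 / 1 * e))))
      (+-nonneg (+-nonneg (*-nonneg (0≤ (+ 15 / 1)) 0≤w) (*-nonneg (0≤ (+ 300 / 1)) (*-nonneg 0≤w 0≤w)))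
                (*-nonneg 0≤σ (*-nonneg (0≤ (+ 3 / 1)) (*-nonneg 0≤e (p-q≥0 far)))))
      (solve 2 (λ e d → (con 1ℚ :- con (+ 3 / 1) :* (e :* d)) :* (con 1ℚ :+ con (+ 10 / 1) :* (e :* e))
           :+ (con (+ 15 / 1) :* (e :* e) :+ con (+ 300 / 1) :* ((e :* e) :* (e :* e))
               :+ (con 1ℚ :+ con (+ 10 / 1) :* (e :* e)) :* (con (+ 3 / 1) :* (e :* (d :- con (+ 10 / 1) :* e))))
         := con 1ℚ :- con (+ 5 / 1) :* (e :* e)) refl e d)

    0≤1+ke : ∀ k → {{NonNegative k}} → 0ℚ ≤ 1ℚ + k * e
    0≤1+ke k = +-nonneg (0≤ 1ℚ) (*-nonneg (0≤ k) 0≤e)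

    0≤1-e : 0ℚ ≤ 1ℚ - e
    0≤1-e = ≤-by (+ 9 / 10 + gap) (+-nonneg (0≤ (+ 9 / 10)) 0≤gap)
      (solve 1 (λ e → con 0ℚ :+ (con (+ 9 / 10) :+ (con (+ 1 / 10) :- e)) := con 1ℚ :- e) refl e)

    0≤1-2e : 0ℚ ≤ 1ℚ - + 2 / 1 * e
    0≤1-2e = ≤-by (+ 8 / 10 + + 2 / 1 * gap) (+-nonneg (0≤ (+ 8 / 10)) (*-nonneg (0≤ (+ 2 / 1)) 0≤gap))
      (solve 1 (λ e → con 0ℚ :+ (con (+ 8 / 10) :+ con (+ 2 / 1) :* (con (+ 1 / 10) :- e)) := con 1ℚ :- con (+ 2 / 1) :* e) refl e)

    0≤1-4e : 0ℚ ≤ 1ℚ - + 4 / 1 * e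
    0≤1-4e = ≤-by (+ 6 / 10 + + 4 / 1 * gap) (+-nonneg (0≤ (+ 6 / 10)) (*-nonneg (0≤ (+ 4 / 1)) 0≤gap))
      (solve 1 (λ e → con 0ℚ :+ (con (+ 6 / 10) :+ con (+ 4 / 1) :* (con (+ 1 / 10) :- e)) := con 1ℚ :- con (+ 4 / 1) :* e) refl e)

  -- The coefficients -2 and 1 of `e` average to 0 under Ber(1/3), so the first-order terms leave
  -- -3e(μ - 1/3) in the mean of `t` and nothing in that of `u`. The coefficients 8 and 1 of `w`
  -- make tu at least 1 and average to 10/3.
  above : ∀ μ → + 10 / 1 * e ≤ μ - ⅓ → Test ρ μ
  above μ far = record
    { t = λ { true → (1ℚ - + 2 / 1 * e) * σ ; false → (1ℚ + 1ℚ * e) * σ }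
    ; u = λ { true → (1ℚ + + 2 / 1 * e + + 8 / 1 * w) * ς ; false → (1ℚ - e + w) * ς }
    ; t-nonneg = λ { true → *-nonneg 0≤1-2e 0≤σ ; false → *-nonneg (0≤1+ke 1ℚ) 0≤σ }
    ; u-nonneg = λ { true  → *-nonneg (+-nonneg (0≤1+ke (+ 2 / 1)) (*-nonneg (0≤ (+ 8 / 1)) 0≤w)) 0≤ς
                   ; false → *-nonneg (+-nonneg 0≤1-e 0≤w) 0≤ς }
    ; 1≤tu = λ
        { true  → scaled (1ℚ - + 2 / 1 * e) (1ℚ + + 2 / 1 * e + + 8 / 1 * w) (1≤-by (+ 4 / 1 * (w * (1ℚ - + 4 / 1 * e))) (*-nonneg (0≤ (+ 4 / 1)) (*-nonneg 0≤w 0≤1-4e))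
            (solve 1 (λ e → con 1ℚ :+ con (+ 4 / 1) :* ((e :* e) :* (con 1ℚ :- con (+ 4 / 1) :* e))
               := (con 1ℚ :- con (+ 2 / 1) :* e) :* (con 1ℚ :+ con (+ 2 / 1) :* e :+ con (+ 8 / 1) :* (e :* e))) refl e))
        ; false → scaled (1ℚ + 1ℚ * e) (1ℚ - e + w) (1≤-by (w * e) (*-nonneg 0≤w 0≤e)
            (solve 1 (λ e → con 1ℚ :+ e :* e :* e := (con 1ℚ :+ con 1ℚ :* e) :* (con 1ℚ :- e :+ e :* e)) refl e))
        }
    ; t-mean = ≤-trans (≤-reflexive
        (solve 3 (λ e s μ → (con 1ℚ :+ con 1ℚ :* e) :* s :+ ((con 1ℚ :- con (+ 2 / 1) :* e) :* s :- (con 1ℚ :+ con 1ℚ :* e) :* s) :* μ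
                   := (con 1ℚ :- con (+ 3 / 1) :* (e :* (μ :- con ⅓))) :* s) refl e σ μ))
        (τ-bound (μ - ⅓) far)
    ; u-mean = ≤-trans (≤-reflexive
        (solve 3 (λ e w s → con (Ber ⅓ false) :* ((con 1ℚ :- e :+ w) :* s) :+ con (Ber ⅓ true) :* ((con 1ℚ :+ con (+ 2 / 1) :* e :+ con (+ 8 / 1) :* w) :* s)
                   := (con 1ℚ :+ con (+ 10 / 3) :* w) :* s) refl e w ς))
        υ-bound
    }

  -- The linear terms change sign. The coefficients 4 and 3 of `w` again average to 10/3, so
  -- `υ-bound` covers both cases.
  below : ∀ μ → + 10 / 1 * e ≤ ⅓ - μ → Test ρ μ
  below μ far = record
    { t = λ { true → (1ℚ + + 2 / 1 * e) * σ ; false → (1ℚ - e) * σ }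
    ; u = λ { true → (1ℚ - + 2 / 1 * e + + 4 / 1 * w) * ς ; false → (1ℚ + 1ℚ * e + + 3 / 1 * w) * ς }
    ; t-nonneg = λ { true → *-nonneg (0≤1+ke (+ 2 / 1)) 0≤σ ; false → *-nonneg 0≤1-e 0≤σ }
    ; u-nonneg = λ { true  → *-nonneg (+-nonneg 0≤1-2e (*-nonneg (0≤ (+ 4 / 1)) 0≤w)) 0≤ς
                   ; false → *-nonneg (+-nonneg (0≤1+ke 1ℚ) (*-nonneg (0≤ (+ 3 / 1)) 0≤w)) 0≤ς }
    ; 1≤tu = λ
        { true  → scaled (1ℚ + + 2 / 1 * e) (1ℚ - + 2 / 1 * e + + 4 / 1 * w) (1≤-by (+ 8 / 1 * (w * e)) (*-nonneg (0≤ (+ 8 / 1)) (*-nonneg 0≤w 0≤e))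
            (solve 1 (λ e → con 1ℚ :+ con (+ 8 / 1) :* (e :* e :* e)
               := (con 1ℚ :+ con (+ 2 / 1) :* e) :* (con 1ℚ :- con (+ 2 / 1) :* e :+ con (+ 4 / 1) :* (e :* e))) refl e))
        ; false → scaled (1ℚ - e) (1ℚ + 1ℚ * e + + 3 / 1 * w) (1≤-by (w * (1ℚ + (1ℚ - + 4 / 1 * e) + e)) (*-nonneg 0≤w (+-nonneg (+-nonneg (0≤ 1ℚ) 0≤1-4e) 0≤e))
            (solve 1 (λ e → con 1ℚ :+ e :* e :* (con 1ℚ :+ (con 1ℚ :- con (+ 4 / 1) :* e) :+ e)
               := (con 1ℚ :- e) :* (con 1ℚ :+ con 1ℚ :* e :+ con (+ 3 / 1) :* (e :* e))) refl e))
        }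
    ; t-mean = ≤-trans (≤-reflexive
        (solve 3 (λ e s μ → (con 1ℚ :- e) :* s :+ ((con 1ℚ :+ con (+ 2 / 1) :* e) :* s :- (con 1ℚ :- e) :* s) :* μ
                   := (con 1ℚ :- con (+ 3 / 1) :* (e :* (con ⅓ :- μ))) :* s) refl e σ μ))
        (τ-bound (⅓ - μ) far)
    ; u-mean = ≤-trans (≤-reflexive
        (solve 3 (λ e w s → con (Ber ⅓ false) :* ((con 1ℚ :+ con 1ℚ :* e :+ con (+ 3 / 1) :* w) :* s) :+ con (Ber ⅓ true) :* ((con 1ℚ :- con (+ 2 / 1) :* e :+ con (+ 4 / 1) :* w) :* s)
                   := (con 1ℚ :+ con (+ 10 / 3) :* w) :* s) refl e w ς))
        υ-bound
    }

  far-test : ∀ μ → + 10 / 1 * e ≤ ∣ μ - ⅓ ∣ → Test ρ μ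
  far-test μ far with ℚ.∣p∣≡p∨∣p∣≡-p (μ - ⅓)
  ... | inj₁ eq = above μ (subst (+ 10 / 1 * e ≤_) eq far)
  ... | inj₂ eq = below μ (subst (+ 10 / 1 * e ≤_) (trans eq (solve 1 (λ μ → :- (μ :- con ⅓) := con ⅓ :- μ) refl μ)) far)

  0≤ρ : 0ℚ ≤ ρ
  0≤ρ = ≤-by (+ 95 / 100 + + 5 / 1 * (+ 1 / 100 - w)) (+-nonneg (0≤ (+ 95 / 100)) (*-nonneg (0≤ (+ 5 / 1)) 0≤gapʷ))
    (solve 1 (λ w → con 0ℚ :+ (con (+ 95 / 100) :+ con (+ 5 / 1) :* (con (+ 1 / 100) :- w)) := con 1ℚ :- con (+ 5 / 1) :* w) refl w)

  0≤5w : 0ℚ ≤ + 5 / 1 * w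
  0≤5w = *-nonneg (0≤ (+ 5 / 1)) 0≤w

-- The induction on the rank.

Rank≤ : ∀ {m} → ℕ → Subspace m → 𝔽₂^ m → (𝔽₂^ m → 𝔽₂) → Set
Rank≤ r V h G = ∃[ L ] length L ℕ.≤ r × Determined V h L G

-- `N` is at least 1/(5e²), which makes ρ^N at most 1/2 by `power≤½`.
module Bound (e : ℚ) (0≤e : 0ℚ ≤ e) (e≤ : e ≤ + 1 / 10) (N : ℕ) (1≤5Ne² : 1ℚ ≤ ℕ→ℚ N * (+ 5 / 1 * (e * e)))
             {m n : ℕ} (P : Fin n → 𝔽₂^ m → 𝔽₂)
             (far : ∀ i V h → + 10 / 1 * e ≤ ∣ 𝔼 V h (𝟙 ∘ P i) - ⅓ ∣) where

  open Tests e 0≤e e≤ using (ρ; 0≤ρ; far-test; 0≤5w)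

  -- The constant 14 is 2·7, with (9/10)^7 ≤ 1/2, for the deterministic outputs at r = 0.
  D : ℕ → ℕ
  D r = 14 ℕ.* (4 ℕ.* N) ℕ.^ r ℕ.* r !

  ρ≤1 : ρ ≤ 1ℚ
  ρ≤1 = ≤-by (+ 5 / 1 * (e * e)) 0≤5w (solve 1 (λ x → con 1ℚ :- x :+ x := con 1ℚ) refl (+ 5 / 1 * (e * e)))

  N-pos : 1 ℕ.≤ N
  N-pos = positive-factor N 1≤5Ne²
    where
    positive-factor : ∀ N {x} → 1ℚ ≤ ℕ→ℚ N * x → 1 ℕ.≤ N
    positive-factor zero {x} le with toWitness {a? = 0ℚ ℚ.<? 1ℚ} _
    ... | 0<1 = ⊥-elim (ℚ.<⇒≢ (ℚ.<-≤-trans 0<1 (≤-trans le (≤-reflexive (ℚ.*-zeroˡ x)))) refl)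
    positive-factor (suc N) _ = ℕ.s≤s ℕ.z≤n

  V⊆V : ∀ {V : Subspace m} → V ⊆ V
  V⊆V v∈ = v∈

  -- Induction on `r` with `s` and the coset free: when few functions are picked, the call at the
  -- next lower rank asks for a larger exponent on smaller cosets.
  bound : ∀ r s V h → (∀ i → Rank≤ r V h (P i)) → s ℕ.* D r ℕ.≤ n → affinity V h P ≤ ½ ^ s
  bound r zero V h rank le = affinity≤1 V h P
  -- At rank 0 all outputs are constant on the coset. A skip would need fewer than 0 forms, so every
  -- function is picked.
  bound zero (suc s) V h rank le with greedy {ρ = + 9 / 10} {0} {V} {h} P V⊆V rank tests
    where
    tests : ∀ i U → U ⊆ V → Test (+ 9 / 10) (𝔼 U h (𝟙 ∘ P i))
    tests i U U⊆V with rank i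
    ... | [] , _ , det = subst (Test (+ 9 / 10))
      (sym (𝔼-determined[] (Determined-∘ 𝟙 (Determined-⊆ U⊆V (self∈ V h) det)))) (deterministic-test (P i h))
  ... | k , U , g = ≤-trans (affinity-certificate (certificate (toWitness {a? = 0ℚ ℚ.≤? + 9 / 10} _) V⊆V g))
      (decay {+ 9 / 10} (toWitness {a? = 0ℚ ℚ.≤? + 9 / 10} _) (toWitness {a? = + 9 / 10 ℚ.≤? 1ℚ} _)
             {7} (toWitness {a? = (+ 9 / 10) ^ 7 ℚ.≤? ½} _) s
             (subst (suc s ℕ.* 14 ℕ.≤_) (sym (all-picked g)) le))
    where
    all-picked : ∀ {n' V k U} {Q : Fin n' → 𝔽₂^ m → 𝔽₂} {ρ W h} → Greedy ρ 0 W h V Q k U → k ≡ n'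
    all-picked done             = refl
    all-picked (pick _ _ _ _ g) = cong suc (all-picked g)
  bound (suc r) (suc s) V h rank le
    with greedy {ρ = ρ} {suc r} {V} {h} P V⊆V rank (λ i U _ → far-test (𝔼 U h (𝟙 ∘ P i)) (far i U h))
  -- `suc s` blocks of 2N picks are what `decay` asks for.
  ... | k , U , g with suc s ℕ.* (2 ℕ.* N) ℕ.≤? k
  ...   | yes many = ≤-trans (affinity-certificate (certificate 0≤ρ V⊆V g))
            (decay 0≤ρ ρ≤1 {N} (power≤½ (+ 5 / 1 * (e * e)) 0≤5w 0≤ρ N 1≤5Ne²) s many)
  ...   | no few = begin
    affinity V h P
      ≤⟨ greedy-mixture V⊆V g P (^-nonneg ½-nonneg (q ℕ.+ suc s))
           (λ {h'} h'∈ → bound r (q ℕ.+ suc s) U h' (greedy-rank V⊆V g h'∈) size) (self∈ V h) ⟩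
    (2ℚ ^ suc r) ^ k * ½ ^ (q ℕ.+ suc s)
      ≡⟨ cong₂ _*_ (^-assocʳ 2ℚ (suc r) k) (^-homo-* ½ q (suc s)) ⟩
    2ℚ ^ j * (½ ^ q * ½ ^ suc s)
      ≤⟨ *-monoˡ (2ℚ ^ j) (^-nonneg 2-nonneg j)
           (ℚ.*-monoʳ-≤-nonNeg (½ ^ suc s) {{nonNegative (^-nonneg ½-nonneg (suc s))}} (^-antitone ½-nonneg ½≤1 j≤q)) ⟩
    2ℚ ^ j * (½ ^ j * ½ ^ suc s)
      ≡⟨ sym (ℚ.*-assoc (2ℚ ^ j) (½ ^ j) (½ ^ suc s)) ⟩
    2ℚ ^ j * ½ ^ j * ½ ^ suc s
      ≡⟨ trans (cong (_* ½ ^ suc s) (2^*½^ j)) (ℚ.*-identityˡ (½ ^ suc s)) ⟩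
    ½ ^ suc s ∎
    where
    open ℚ.≤-Reasoning
    q j : ℕ
    -- Below the threshold at most 2^q cosets arise; the extra exponent `q` in the inductive call
    -- cancels their number.
    q = suc r ℕ.* (suc s ℕ.* (2 ℕ.* N))
    j = suc r ℕ.* k
    j≤q : j ℕ.≤ q
    j≤q = ℕ.*-monoʳ-≤ (suc r) (ℕ.<⇒≤ (ℕ.≰⇒> few))
    size : (q ℕ.+ suc s) ℕ.* D r ℕ.≤ n
    -- Since `suc s` is at most `q`, the demand is at most 2q · D_r, which equals (s+1) · D_(r+1):
    -- hence the factor 4N and the factorial in `D`.
    size = ℕ.≤-trans (ℕ.≤-trans (ℕ.*-monoˡ-≤ (D r) (ℕ.+-monoʳ-≤ q room)) (ℕ.≤-reflexive rearrange)) le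
      where
      room : suc s ℕ.≤ q
      room = ℕ.≤-trans (ℕ.m≤m*n (suc s) (2 ℕ.* N) {{ℕ.>-nonZero (ℕ.≤-trans N-pos (ℕ.m≤n*m N 2))}})
                                  (ℕ.m≤n*m (suc s ℕ.* (2 ℕ.* N)) (suc r))
      rearrange : (q ℕ.+ q) ℕ.* D r ≡ suc s ℕ.* D (suc r)
      rearrange = S.solve 5 (λ r s N p f →
        (r S.:* (s S.:* (S.con 2 S.:* N)) S.:+ r S.:* (s S.:* (S.con 2 S.:* N))) S.:* (S.con 14 S.:* p S.:* f)
        S.:= s S.:* (S.con 14 S.:* ((S.con 4 S.:* N) S.:* p) S.:* (r S.:* f))) refl (suc r) (suc s) N ((4 ℕ.* N) ℕ.^ r) (r !)
        where module S = ℕ-Solver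

-- Probabilities as averages over cosets, and distance as affinity.

/-*-cancel : ∀ i b .{{_ : ℕ.NonZero b}} → (i / b) * ℕ→ℚ b ≡ fromℤ i
/-*-cancel i b@(suc b-1) = ℚ.toℚᵘ-injective (begin
  toℚᵘ ((i / b) * ℕ→ℚ b)              ≈⟨ ℚ.toℚᵘ-homo-* (i / b) (ℕ→ℚ b) ⟩
  toℚᵘ (i / b) ℚᵘ.* toℚᵘ (ℕ→ℚ b)      ≈⟨ ℚᵘ.*-cong (ℚ.toℚᵘ-fromℚᵘ (mkℚᵘ i b-1)) (ℚ.toℚᵘ-fromℚᵘ (mkℚᵘ (+ b) 0)) ⟩
  mkℚᵘ i b-1 ℚᵘ.* mkℚᵘ (+ b) 0        ≈⟨ ℚᵘ.*≡* (trans (ℤ.*-identityʳ (i ℤ.* + b)) (cong (λ c → i ℤ.* + c) (sym (ℕ.*-identityʳ b)))) ⟩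
  mkℚᵘ i 0                            ≈⟨ ℚᵘ.≃-sym (ℚ.toℚᵘ-fromℚᵘ (mkℚᵘ i 0)) ⟩
  toℚᵘ (fromℤ i)                      ∎)
  where open ℚᵘ.≃-Reasoning

sum-filter : ∀ {A : Set} (p : A → Bool) (F : A → ℚ) xs →
             sumℚ (List.map F (List.filter (λ x → T? (p x)) xs)) ≡ sumℚ (List.map (λ x → 𝟙 (p x) * F x) xs)
sum-filter p F []       = refl
sum-filter p F (x ∷ xs) with p x
... | true  = cong₂ _+_ (sym (ℚ.*-identityˡ (F x))) (sum-filter p F xs)
... | false = trans (sum-filter p F xs)
                    (sym (trans (cong (_+ rest) (ℚ.*-zeroˡ (F x))) (ℚ.+-identityˡ rest)))
  where rest = sumℚ (List.map (λ x → 𝟙 (p x) * F x) xs)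

length-filter : ∀ {A : Set} {Q : A → Set} (Q? : Decidable Q) xs →
                ℕ→ℚ (length (List.filter Q? xs)) ≡ sumℚ (List.map (λ x → 𝟙 (does (Q? x))) xs)
length-filter Q? []       = refl
length-filter Q? (x ∷ xs) with does (Q? x)
... | true  = trans (ℕ→ℚ-+ 1 (length (List.filter Q? xs))) (cong (λ z → 1ℚ + z) (length-filter Q? xs))
... | false = trans (length-filter Q? xs) (sym (ℚ.+-identityˡ _))

length-sum : ∀ {A : Set} (xs : List A) → ℕ→ℚ (length xs) ≡ sumℚ (List.map (λ _ → 1ℚ) xs)
length-sum []       = refl
length-sum (x ∷ xs) = trans (ℕ→ℚ-+ 1 (length xs)) (cong (λ z → 1ℚ + z) (length-sum xs))

-- The size of the list is `mass V`, so both sides count the favourable points and divide by it. The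
-- hypothesis `sums` lets one proof serve cosets and the cube.
law-as-𝔼 : ∀ {m} {B : Set} (_≟_ : DecidableEquality B) (V : Subspace m) h xs .{{_ : ℕ.NonZero (length xs)}}
           (f : 𝔽₂^ m → B) b → (∀ F → sumℚ (List.map F xs) ≡ total V h F) →
           law _≟_ xs f b ≡ 𝔼 V h (λ x → 𝟙 (does (f x ≟ b)))
law-as-𝔼 _≟_ V h xs f b sums = begin
  ℓ                              ≡⟨ sym (ℚ.*-identityʳ ℓ) ⟩
  ℓ * 1ℚ                         ≡⟨ cong (ℓ *_) (sym (weight*mass V)) ⟩
  ℓ * (weight V * mass V)        ≡⟨ solve 3 (λ l w s → l :* (w :* s) := w :* (l :* s)) refl ℓ (weight V) (mass V) ⟩
  weight V * (ℓ * mass V)        ≡⟨ cong (λ s → weight V * (ℓ * s)) (sym size) ⟩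
  weight V * (ℓ * ℕ→ℚ (length xs)) ≡⟨ cong (weight V *_) (/-*-cancel (+ count) (length xs)) ⟩
  weight V * ℕ→ℚ count           ≡⟨ cong (weight V *_) (trans (length-filter (λ x → f x ≟ b) xs) (sums _)) ⟩
  𝔼 V h (λ x → 𝟙 (does (f x ≟ b))) ∎
  where
  open ≡-Reasoning
  ℓ = law _≟_ xs f b
  count = length (List.filter (λ x → f x ≟ b) xs)
  size : ℕ→ℚ (length xs) ≡ mass V
  size = trans (length-sum xs) (trans (sums (λ _ → 1ℚ)) (∑-cong (λ v → ℚ.*-identityʳ (𝟙 (member V v)))))

coset-total : ∀ {m} (V : Subspace m) h F → sumℚ (List.map F (coset V h)) ≡ total V h F
coset-total {m} V h F = begin
  sumℚ (List.map F (List.map (_⊕ h) members))                     ≡⟨ cong sumℚ (sym (List.map-∘ members)) ⟩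
  sumℚ (List.map (F ∘ (_⊕ h)) members)                            ≡⟨ sum-filter (member V) (F ∘ (_⊕ h)) (cube m) ⟩
  sumℚ (List.map (λ v → 𝟙 (member V v) * F (v ⊕ h)) (cube m))     ≡⟨ sum-cube (λ v → 𝟙 (member V v) * F (v ⊕ h)) ⟩
  total V h F                                                     ∎
  where
  open ≡-Reasoning
  members = List.filter (λ v → T? (member V v)) (cube m)

full : ∀ {m} → Subspace m
full = record { member = λ _ → true ; 0∈ = _ ; ⊕-closed = λ _ _ _ _ → _ }

cube-total : ∀ {m} F → sumℚ (List.map F (cube m)) ≡ total full 0ᵥ F
cube-total F = trans (sum-cube F) (∑-cong (λ v → sym (trans (ℚ.*-identityˡ (F (v ⊕ 0ᵥ))) (cong F (⊕-identityʳ v)))))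

-- The deviations at `false` and `true` are opposite, so half the sum of their absolute values is
-- one of these.
TV₁-coset : ∀ {m} (V : Subspace m) h G → TV₁ (cosetLaw V h G) (Ber ⅓) ≡ ∣ 𝔼 V h (𝟙 ∘ G) - ⅓ ∣
TV₁-coset V h G = begin
  ½ * (∣ cosetLaw V h G false - Ber ⅓ false ∣ + (∣ cosetLaw V h G true - ⅓ ∣ + 0ℚ))
    ≡⟨ cong₂ (λ p q → ½ * (∣ p - Ber ⅓ false ∣ + (∣ q - ⅓ ∣ + 0ℚ))) (at false) (at true) ⟩
  ½ * (∣ 1ℚ + (0ℚ - 1ℚ) * μ - Ber ⅓ false ∣ + (∣ 0ℚ + (1ℚ - 0ℚ) * μ - ⅓ ∣ + 0ℚ))
    ≡⟨ cong₂ (λ p q → ½ * (∣ p ∣ + (∣ q ∣ + 0ℚ)))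
         (solve 1 (λ μ → con 1ℚ :+ (con 0ℚ :- con 1ℚ) :* μ :- con (Ber ⅓ false) := :- (μ :- con ⅓)) refl μ)
         (solve 1 (λ μ → con 0ℚ :+ (con 1ℚ :- con 0ℚ) :* μ :- con ⅓ := μ :- con ⅓) refl μ) ⟩
  ½ * (∣ - (μ - ⅓) ∣ + (∣ μ - ⅓ ∣ + 0ℚ))
    ≡⟨ cong (λ p → ½ * (p + (∣ μ - ⅓ ∣ + 0ℚ))) (ℚ.∣-p∣≡∣p∣ (μ - ⅓)) ⟩
  ½ * (∣ μ - ⅓ ∣ + (∣ μ - ⅓ ∣ + 0ℚ))
    ≡⟨ solve 1 (λ d → con ½ :* (d :+ (d :+ con 0ℚ)) := d) refl ∣ μ - ⅓ ∣ ⟩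
  ∣ μ - ⅓ ∣ ∎
  where
  open ≡-Reasoning
  μ = 𝔼 V h (𝟙 ∘ G)
  at : ∀ b → cosetLaw V h G b ≡ 𝟙 (does (false Bool.≟ b)) + (𝟙 (does (true Bool.≟ b)) - 𝟙 (does (false Bool.≟ b))) * μ
  at b = trans (law-as-𝔼 Bool._≟_ V h (coset V h) {{coset-nonempty V h}} G b (coset-total V h))
               (𝔼-bit V h (λ c → 𝟙 (does (c Bool.≟ b))) G)

⊓-as-difference : ∀ p q → p ⊓ q ≡ ½ * (p + q) + - ½ * ∣ p - q ∣
⊓-as-difference p q with ℚ.≤-total p q
... | inj₁ p≤q = trans (ℚ.p≤q⇒p⊓q≡p p≤q) (sym (trans
  (cong (λ d → ½ * (p + q) + - ½ * d) (trans (cong ∣_∣ (solve 2 (λ p q → p :- q := :- (q :- p)) refl p q))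
     (trans (ℚ.∣-p∣≡∣p∣ (q - p)) (ℚ.0≤p⇒∣p∣≡p (p-q≥0 p≤q)))))
  (solve 2 (λ p q → con ½ :* (p :+ q) :+ con (- ½) :* (q :- p) := p) refl p q)))
... | inj₂ q≤p = trans (ℚ.p≥q⇒p⊓q≡q q≤p) (sym (trans
  (cong (λ d → ½ * (p + q) + - ½ * d) (ℚ.0≤p⇒∣p∣≡p (p-q≥0 q≤p)))
  (solve 2 (λ p q → con ½ :* (p :+ q) :+ con (- ½) :* (p :- q) := q) refl p q)))

∑-prob≡1 : ∀ {m n} (V : Subspace m) h (P : Fin n → 𝔽₂^ m → 𝔽₂) → ∑ (prob V h P) ≡ 1ℚ
∑-prob≡1 V h P = trans (∑-cong (λ y → sym (ℚ.*-identityˡ (prob V h P y))))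
                       (trans (∑-prob V h P (λ _ → 1ℚ)) (𝔼-const V h 1ℚ))

-- The minimum of p and q is (p + q - |p - q|)/2, and both distributions have total mass 1.
TV-affinity : ∀ {m n} (P : Fin n → 𝔽₂^ m → 𝔽₂) → 1ℚ - TVⁿ (jointLaw P) (Ber ⅓ ⊗^ n) ≡ affinity full 0ᵥ P
TV-affinity {m} {n} P = begin
  1ℚ - ½ * sumℚ (List.map (λ y → ∣ jointLaw P y - bern y ∣) (cube n))
    ≡⟨ cong (λ s → 1ℚ - ½ * s) (trans (sum-cube (λ y → ∣ jointLaw P y - bern y ∣))
         (∑-cong (λ y → cong (λ q → ∣ q - bern y ∣) (law-as-𝔼 (Vec.≡-dec Bool._≟_) full 0ᵥ (cube m) {{cube-nonempty m}} (outcome P) y cube-total)))) ⟩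
  1ℚ - ½ * d
    ≡⟨ solve 1 (λ d → con 1ℚ :- con ½ :* d := con ½ :* (con 1ℚ :+ con 1ℚ) :+ con (- ½) :* d) refl d ⟩
  ½ * (1ℚ + 1ℚ) + - ½ * d
    ≡⟨ cong₂ (λ a b → ½ * (a + b) + - ½ * d) (sym (∑-prob≡1 full 0ᵥ P)) (sym (∑-bern n)) ⟩
  ½ * (∑ p + ∑ {n} bern) + - ½ * d
    ≡⟨ cong (λ s → ½ * s + - ½ * d) (sym (∑-+ p bern)) ⟩
  ½ * ∑ (λ y → p y + bern y) + - ½ * d
    ≡⟨ cong₂ _+_ (sym (∑-* ½ (λ y → p y + bern y))) (sym (∑-* (- ½) (λ y → ∣ p y - bern y ∣))) ⟩
  ∑ (λ y → ½ * (p y + bern y)) + ∑ (λ y → - ½ * ∣ p y - bern y ∣)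
    ≡⟨ sym (∑-+ (λ y → ½ * (p y + bern y)) (λ y → - ½ * ∣ p y - bern y ∣)) ⟩
  ∑ (λ y → ½ * (p y + bern y) + - ½ * ∣ p y - bern y ∣)
    ≡⟨ ∑-cong (λ y → sym (⊓-as-difference (p y) (bern y))) ⟩
  affinity full 0ᵥ P ∎
  where
  open ≡-Reasoning
  p : 𝔽₂^ n → ℚ
  p = prob full 0ᵥ P
  d = ∑ (λ y → ∣ p y - bern y ∣)

-- From `Rank₁` to lists of linear forms.

coeffs : ∀ {m k} → Vec (Affine m) k → List (𝔽₂^ m)
coeffs []      = []
coeffs (ℓ ∷ L) = Affine.coeff ℓ ∷ coeffs L

length-coeffs : ∀ {m k} (L : Vec (Affine m) k) → length (coeffs L) ≡ k
length-coeffs []      = refl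
length-coeffs (ℓ ∷ L) = cong suc (length-coeffs L)

xor-false : ∀ a b → a xor b ≡ false → a ≡ b
xor-false false b eq = sym eq
xor-false true  true eq = refl

eval-agree : ∀ {m k} (L : Vec (Affine m) k) {x y} → (x ⊕ y) ⟂ coeffs L →
             Vec.map (λ ℓ → Affine.eval ℓ x) L ≡ Vec.map (λ ℓ → Affine.eval ℓ y) L
eval-agree []      _               = refl
eval-agree (ℓ ∷ L) {x} {y} (eq ∷ xy) = cong₂ _∷_
  (cong (Affine.const ℓ xor_) (xor-false _ _ (trans (sym (dot-⊕ (Affine.coeff ℓ) x y)) eq)))
  (eval-agree L xy)

-- If the linear parts vanish on `x ⊕ y`, the affine forms agree at both points and `Γ` receives the
-- same arguments. The zero function, of rank 0, takes the empty list.
rank₁⇒rank≤ : ∀ {m k r} {V : Subspace m} {h} {G : 𝔽₂^ m → 𝔽₂} → Rank₁ G k → k ℕ.≤ r → Rank≤ r V h G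
rank₁⇒rank≤ (rank-zero zero≡) _ = [] , ℕ.z≤n , determined λ {x} {y} _ _ _ → trans (zero≡ x) (sym (zero≡ y))
rank₁⇒rank≤ {r = r} (rank-nonzero _ _ (L , Γ , factors) _) k≤r =
  coeffs L , subst (ℕ._≤ r) (sym (length-coeffs L)) k≤r ,
  determined λ {x} {y} _ _ xy → trans (factors x) (trans (cong Γ (eval-agree L xy)) (sym (factors y)))

-- Passing from the real δ to rationals

m<[1+m/n]*n : ∀ m n .{{_ : ℕ.NonZero n}} → m ℕ.< suc (m ℕ./ n) ℕ.* n
m<[1+m/n]*n m n = subst (ℕ._< suc (m ℕ./ n) ℕ.* n) (sym (ℕ.m≡m%n+[m/n]*n m n))
  (ℕ.+-monoˡ-< (m ℕ./ n ℕ.* n) (ℕ.m%n<n m n))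

-- `N` is ⌊1/x⌋ + 1, so Nx lies between 1 and 1 + x. The absolute constant in `rate-bound` rests on
-- the upper bound.
archimedean : ∀ x → 0ℚ < x → ∃[ N ] 1ℚ ≤ ℕ→ℚ N * x × (x ≤ 1ℚ → ℕ→ℚ N * x ≤ + 2 / 1)
archimedean x@(mkℚ (+ suc a) d _) _ = N , lower , upper
  where
  open ℚ.≤-Reasoning
  N : ℕ
  N = suc (suc d ℕ./ suc a)
  q : ℚ
  q = ℕ→ℚ (suc d)
  instance
    q-pos : Positive q
    q-pos = ℚ.normalize-pos (suc d) 1
  xq : x * q ≡ ℕ→ℚ (suc a)
  xq = trans (cong (_* q) (sym (ℚ.↥p/↧p≡p x))) (/-*-cancel (+ suc a) (suc d))
  Nxq : ℕ→ℚ N * x * q ≡ ℕ→ℚ (N ℕ.* suc a)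
  Nxq = trans (ℚ.*-assoc (ℕ→ℚ N) x q) (trans (cong (ℕ→ℚ N *_) xq) (sym (ℕ→ℚ-* N (suc a))))
  lower : 1ℚ ≤ ℕ→ℚ N * x
  lower = ℚ.*-cancelʳ-≤-pos q (begin
    1ℚ * q             ≡⟨ ℚ.*-identityˡ q ⟩
    ℕ→ℚ (suc d)        ≤⟨ ℕ→ℚ-mono (ℕ.<⇒≤ (m<[1+m/n]*n (suc d) (suc a))) ⟩
    ℕ→ℚ (N ℕ.* suc a)  ≡⟨ sym Nxq ⟩
    ℕ→ℚ N * x * q      ∎)
  upper : x ≤ 1ℚ → ℕ→ℚ N * x ≤ + 2 / 1
  upper x≤1 = ℚ.*-cancelʳ-≤-pos q (begin
    ℕ→ℚ N * x * q        ≡⟨ Nxq ⟩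
    ℕ→ℚ (N ℕ.* suc a)    ≤⟨ ℕ→ℚ-mono (ℕ.+-mono-≤ a≤d (ℕ.m/n*n≤m (suc d) (suc a))) ⟩
    ℕ→ℚ (suc d ℕ.+ suc d) ≡⟨ ℕ→ℚ-+ (suc d) (suc d) ⟩
    q + q                ≡⟨ solve 1 (λ q → q :+ q := con (+ 2 / 1) :* q) refl q ⟩
    + 2 / 1 * q          ∎)
    where
    a≤d : suc a ℕ.≤ suc d
    a≤d = ℤ.drop‿+≤+ (fromℤ-cancel-≤ (≤-trans (≤-reflexive (sym xq))
            (≤-trans (ℚ.*-monoʳ-≤-nonNeg q {{ℚ.pos⇒nonNeg q}} x≤1) (≤-reflexive (ℚ.*-identityˡ q)))))
archimedean (mkℚ (+ zero) d _) 0<x with ℚ.drop-*<* 0<x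
... | ℤ.+<+ ()
archimedean (mkℚ -[1+ a ] d _) 0<x with ℚ.drop-*<* 0<x
... | ()

pos-half : ∀ ε → 0ℚ < ε → 0ℚ < ½ * ε
pos-half ε 0<ε = ℚ.positive⁻¹ (½ * ε) {{ℚ.pos*pos⇒pos ½ ε {{positive 0<ε}}}}

-- `η` stands in for `δ`: it lies below every rational that `δ` bounds from below, and `δ` is
-- eventually at most 3η, which costs only a constant in the rate.
rational-below : ∀ δ → ι 0ℚ <ᵣ δ →
  ∃[ η ] 0ℚ < η × (∃[ M ] ∀ i → M ℕ.≤ i → 0ℚ ≤ seq δ i × seq δ i ≤ + 3 / 1 * η) × (∀ q → δ ≤ᵣ ι q → η ≤ q)
rational-below δ (ε , 0<ε , N₁ , above) with cauchy δ (½ * (½ * ε)) (pos-half (½ * ε) (pos-half ε 0<ε))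
... | N₂ , close = η , 0<η , (M , λ i M≤i → ≤-trans 0≤ε (ε≤ i (ℕ.≤-trans (ℕ.m≤m⊔n N₁ N₂) M≤i)) , near i M≤i) , below
  where
  open ℚ.≤-Reasoning
  M = N₁ ℕ.⊔ N₂
  s = seq δ M
  -- Two errors of ε/4, from the Cauchy condition and from `≤ᵣ`, fit into ε/2, and s ≥ ε leaves η ≥
  -- ε/2.
  η = s - ½ * ε
  0≤ε : 0ℚ ≤ ε
  0≤ε = ℚ.<⇒≤ 0<ε
  ε≤ : ∀ i → N₁ ℕ.≤ i → ε ≤ seq δ i
  ε≤ i N₁≤i = ≤-trans (≤-reflexive (sym (ℚ.+-identityˡ ε))) (above i N₁≤i)
  ε≤s : ε ≤ s
  ε≤s = ε≤ M (ℕ.m≤m⊔n N₁ N₂)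
  0<η : 0ℚ < η
  0<η = ℚ.<-≤-trans (pos-half ε 0<ε)
    (≤-by (s - ε) (p-q≥0 ε≤s) (solve 2 (λ s ε → con ½ :* ε :+ (s :- ε) := s :- con ½ :* ε) refl s ε))
  ∣∣-upper : ∀ p → p ≤ ∣ p ∣
  ∣∣-upper p with ℚ.≤-total 0ℚ p
  ... | inj₁ 0≤p = ≤-reflexive (sym (ℚ.0≤p⇒∣p∣≡p 0≤p))
  ... | inj₂ p≤0 = ≤-trans p≤0 (ℚ.0≤∣p∣ p)
  within : ∀ i j → M ℕ.≤ i → M ℕ.≤ j → seq δ i ≤ seq δ j + ½ * (½ * ε)
  within i j M≤i M≤j = begin
    seq δ i                           ≡⟨ solve 2 (λ a b → a := b :+ (a :- b)) refl (seq δ i) (seq δ j) ⟩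
    seq δ j + (seq δ i - seq δ j)     ≤⟨ ℚ.+-monoʳ-≤ (seq δ j) (≤-trans (∣∣-upper (seq δ i - seq δ j))
        (ℚ.<⇒≤ (close i j (ℕ.≤-trans (ℕ.m≤n⊔m N₁ N₂) M≤i) (ℕ.≤-trans (ℕ.m≤n⊔m N₁ N₂) M≤j)))) ⟩
    seq δ j + ½ * (½ * ε)             ∎
  near : ∀ i → M ℕ.≤ i → seq δ i ≤ + 3 / 1 * η
  near i M≤i = ≤-trans (within i M M≤i ℕ.≤-refl)
    (≤-by (+ 2 / 1 * (s - ε) + ½ * (½ * ε)) (+-nonneg (*-nonneg (ℚ.nonNegative⁻¹ (+ 2 / 1)) (p-q≥0 ε≤s))
                                                     (*-nonneg ½-nonneg (*-nonneg ½-nonneg 0≤ε)))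
      (solve 2 (λ s ε → s :+ con ½ :* (con ½ :* ε) :+ (con (+ 2 / 1) :* (s :- ε) :+ con ½ :* (con ½ :* ε))
                     := con (+ 3 / 1) :* (s :- con ½ :* ε)) refl s ε))
  below : ∀ q → δ ≤ᵣ ι q → η ≤ q
  below q δ≤q with δ≤q (½ * (½ * ε)) (pos-half (½ * ε) (pos-half ε 0<ε))
  ... | N₃ , le = begin
    s - ½ * ε                                 ≤⟨ ℚ.+-monoˡ-≤ (- (½ * ε)) (≤-trans
        (within M i ℕ.≤-refl (ℕ.m≤m⊔n M N₃)) (ℚ.+-monoˡ-≤ (½ * (½ * ε)) (le i (ℕ.m≤n⊔m M N₃)))) ⟩
    q + ½ * (½ * ε) + ½ * (½ * ε) - ½ * ε     ≡⟨ solve 2 (λ q ε → q :+ con ½ :* (con ½ :* ε) :+ con ½ :* (con ½ :* ε) :- con ½ :* ε := q) refl q ε ⟩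
    q                                         ∎
    where i = M ℕ.⊔ N₃

-- Comparison with real powers of two.

seq-^ : ∀ x k i → seq (x ^ᵣ k) i ≡ seq x i ^ k
seq-^ x zero    i = refl
seq-^ x (suc k) i = cong (seq x i *_) (seq-^ x k i)

-- With p = a/(b+1), the claim is W^(b+1) ≤ 2^a, and -s ≤ p says -s(b+1) ≤ a.
½^≤2^ : ∀ {W} s → 0ℚ ≤ W → W ≤ ½ ^ s → ∀ p → - ℕ→ℚ s ≤ p → W ≤2^ℚ p
½^≤2^ {W} s 0≤W W≤ p@(mkℚ a b _) -s≤p = inj₂ (≤-trans power (compare a exponent))
  where
  power : W ^ suc b ≤ ½ ^ (s ℕ.* suc b)
  power = ≤-trans (^-mono 0≤W W≤ (suc b)) (≤-reflexive (^-assocʳ ½ s (suc b)))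
  exponent : ℤ.- (+ (s ℕ.* suc b)) ℤ.≤ a
  exponent = subst₂ ℤ._≤_
    (trans (sym (ℤ.neg-distribˡ-* (+ s) (+ suc b))) (cong ℤ.-_ (sym (ℤ.pos-* s (suc b)))))
    (ℤ.*-identityʳ a)
    (ℚ.drop-*≤* (subst (_≤ p) (trans (cong -_ (sym (fromℤ-mkℚ (+ s)))) (neg-mkℚ s)) -s≤p))
    where
    neg-mkℚ : ∀ s → - mkℚ (+ s) 0 (Coprime.sym (Coprime.1-coprimeTo s)) ≡ mkℚ (ℤ.- (+ s)) 0 (Coprime.sym (Coprime.1-coprimeTo ℤ.∣ ℤ.- (+ s) ∣))
    neg-mkℚ zero    = refl
    neg-mkℚ (suc s) = refl
  compare : ∀ a → ℤ.- (+ (s ℕ.* suc b)) ℤ.≤ a → ½ ^ (s ℕ.* suc b) ≤ 2^ℤ a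
  compare (+ k)      _  = ≤-trans (^≤1 ½-nonneg ½≤1 (s ℕ.* suc b)) (1≤2^ k)
  compare (-[1+ k ]) le = ^-antitone ½-nonneg ½≤1 (ℤ.drop‿+≤+ (ℤ.neg-cancel-≤ le))

-- The bound for rational parameters.

-- Gives η ≤ 1 in `exponential-bound`, so that e = η/10 meets the condition e ≤ 1/10 of the tests.
bias≤1 : ∀ {m} (V : Subspace m) h G → ∣ 𝔼 V h (𝟙 ∘ G) - ⅓ ∣ ≤ 1ℚ
bias≤1 V h G with ℚ.∣p∣≡p∨∣p∣≡-p (𝔼 V h (𝟙 ∘ G) - ⅓)
... | inj₁ eq = ≤-trans (≤-reflexive eq) (≤-by ((1ℚ - μ) + ⅓) (+-nonneg (p-q≥0 μ≤1) (ℚ.nonNegative⁻¹ ⅓))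
                  (solve 1 (λ μ → μ :- con ⅓ :+ ((con 1ℚ :- μ) :+ con ⅓) := con 1ℚ) refl μ))
  where
  μ = 𝔼 V h (𝟙 ∘ G)
  𝟙≤1 : ∀ b → 𝟙 b ≤ 1ℚ
  𝟙≤1 true  = ≤-refl
  𝟙≤1 false = ℚ.nonNegative⁻¹ 1ℚ
  μ≤1 : μ ≤ 1ℚ
  μ≤1 = ≤-trans (𝔼-mono V h (𝟙≤1 ∘ G)) (≤-reflexive (𝔼-const V h 1ℚ))
... | inj₂ eq = ≤-trans (≤-reflexive eq) (≤-by (μ + + 2 / 3) (+-nonneg (𝔼-nonneg V h (𝟙-nonneg ∘ G)) (ℚ.nonNegative⁻¹ (+ 2 / 3)))
                  (solve 1 (λ μ → :- (μ :- con ⅓) :+ (μ :+ con (+ 2 / 3)) := con 1ℚ) refl μ))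
  where μ = 𝔼 V h (𝟙 ∘ G)

affinity-nonneg : ∀ {m n} (V : Subspace m) h (P : Fin n → 𝔽₂^ m → 𝔽₂) → 0ℚ ≤ affinity V h P
affinity-nonneg V h P = ∑-nonneg (λ y → ℚ.⊓-glb (prob-nonneg V h P y) (bern-nonneg y))

-- Chosen so that 14 · (c₀ d² · 4N) ≤ 14 · 720 c₀ · 2 = 1 in rate-bound.
abstract
  c₀ : ℚ
  c₀ = + 1 / 28 * (+ 1 / 720)

  720c₀ : + 720 / 1 * c₀ ≡ + 1 / 28
  720c₀ = trans (solve 3 (λ a b c → a :* (b :* c) := b :* (c :* a)) refl (+ 720 / 1) (+ 1 / 28) (+ 1 / 720))
    (trans (cong (+ 1 / 28 *_) (/-*-cancel (+ 1) 720)) (ℚ.*-identityʳ (+ 1 / 28)))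

  0<c₀ : 0ℚ < c₀
  0<c₀ = ℚ.positive⁻¹ c₀ {{ℚ.pos*pos⇒pos (+ 1 / 28) (+ 1 / 720)}}

0≤c₀ : 0ℚ ≤ c₀
0≤c₀ = ℚ.<⇒≤ 0<c₀

rate : ℕ → ℚ → ℕ → ℚ
rate r d n = c₀ ^ r * d ^ (2 ℕ.* r) * _/_ (+ 1) (r !) {{r ℕ.!≢0}} * ℕ→ℚ n

-- Inserting n ≤ (s+1) · D_r cancels the factorial and leaves (s+1) · 14 · (c₀d² · 4N)^r.
rate-bound : ∀ r → 1 ℕ.≤ r → ∀ {d η} → 0ℚ ≤ d → d ≤ + 3 / 1 * η → ∀ N s n →
             ℕ→ℚ N * (+ 5 / 1 * ((+ 1 / 10 * η) * (+ 1 / 10 * η))) ≤ + 2 / 1 →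
             n ℕ.≤ suc s ℕ.* (14 ℕ.* (4 ℕ.* N) ℕ.^ r ℕ.* r !) →
             rate r d n ≤ ℕ→ℚ (suc s)
rate-bound (suc r') _ {d} {η} 0≤d d≤3η N s n N≤ n≤ = begin
  c₀ ^ r * d ^ (2 ℕ.* r) * f * ℕ→ℚ n
    ≡⟨ trans (ℚ.*-assoc (c₀ ^ r * d ^ (2 ℕ.* r)) f (ℕ→ℚ n)) (cong (λ z → c₀ ^ r * z * (f * ℕ→ℚ n)) square) ⟩
  c₀ ^ r * (d * d) ^ r * (f * ℕ→ℚ n)
    ≤⟨ *-monoˡ (c₀ ^ r * (d * d) ^ r) (*-nonneg (^-nonneg 0≤c₀ r) (^-nonneg (*-nonneg 0≤d 0≤d) r))
         (*-monoˡ f (ℚ.<⇒≤ f-pos) (≤-trans (ℕ→ℚ-mono n≤) (≤-reflexive cast))) ⟩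
  c₀ ^ r * (d * d) ^ r * (f * (S * (+ 14 / 1 * q ^ r * F)))
    ≡⟨ solve 6 (λ c d f S q F → c :* d :* (f :* (S :* (con (+ 14 / 1) :* q :* F))) := (f :* F) :* (S :* (con (+ 14 / 1) :* (c :* d :* q))))
         refl (c₀ ^ r) ((d * d) ^ r) f S (q ^ r) F ⟩
  (f * F) * (S * (+ 14 / 1 * (c₀ ^ r * (d * d) ^ r * q ^ r)))
    ≡⟨ cong₂ (λ a b → a * (S * (+ 14 / 1 * b))) (/-*-cancel (+ 1) (r !) {{r ℕ.!≢0}})
         (sym (trans (^-distrib-* (c₀ * (d * d)) q r) (cong (_* q ^ r) (^-distrib-* c₀ (d * d) r)))) ⟩
  1ℚ * (S * (+ 14 / 1 * (c₀ * (d * d) * q) ^ r))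
    ≡⟨ ℚ.*-identityˡ _ ⟩
  S * (+ 14 / 1 * (c₀ * (d * d) * q) ^ r)
    ≤⟨ *-monoˡ S (ℕ→ℚ-nonneg (suc s)) (*-monoˡ (+ 14 / 1) (ℚ.nonNegative⁻¹ (+ 14 / 1))
         -- As r ≥ 1, one factor 1/14 is available to cancel the 14 of D_r; the others are at most
         -- 1.
         (≤-trans (^-mono base-nonneg base≤ r) (*-monoˡ (+ 1 / 14) (ℚ.nonNegative⁻¹ (+ 1 / 14))
           (^≤1 (ℚ.nonNegative⁻¹ (+ 1 / 14)) (toWitness {a? = + 1 / 14 ℚ.≤? 1ℚ} _) r')))) ⟩
  S * (+ 14 / 1 * (+ 1 / 14 * 1ℚ))
    ≡⟨ ℚ.*-identityʳ S ⟩
  S ∎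
  where
  open ℚ.≤-Reasoning
  r : ℕ
  r = suc r'
  f S q F : ℚ
  f = _/_ (+ 1) (r !) {{r ℕ.!≢0}}
  S = ℕ→ℚ (suc s)
  q = ℕ→ℚ (4 ℕ.* N)
  F = ℕ→ℚ (r !)
  f-pos : 0ℚ < f
  f-pos = ℚ.positive⁻¹ f {{ℚ.normalize-pos 1 (r !) {{r ℕ.!≢0}}}}
  square : d ^ (2 ℕ.* r) ≡ (d * d) ^ r
  square = trans (sym (^-assocʳ d 2 r)) (cong (λ z → (d * z) ^ r) (ℚ.*-identityʳ d))
  ℕ→ℚ-^ : ∀ a k → ℕ→ℚ (a ℕ.^ k) ≡ ℕ→ℚ a ^ k
  ℕ→ℚ-^ a zero    = refl
  ℕ→ℚ-^ a (suc k) = trans (ℕ→ℚ-* a (a ℕ.^ k)) (cong (ℕ→ℚ a *_) (ℕ→ℚ-^ a k))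
  cast : ℕ→ℚ (suc s ℕ.* (14 ℕ.* (4 ℕ.* N) ℕ.^ r ℕ.* r !)) ≡ S * (+ 14 / 1 * q ^ r * F)
  cast = trans (ℕ→ℚ-* (suc s) (14 ℕ.* (4 ℕ.* N) ℕ.^ r ℕ.* r !)) (cong (S *_) (trans (ℕ→ℚ-* (14 ℕ.* (4 ℕ.* N) ℕ.^ r) (r !))
    (cong (_* F) (trans (ℕ→ℚ-* 14 ((4 ℕ.* N) ℕ.^ r)) (cong (+ 14 / 1 *_) (ℕ→ℚ-^ (4 ℕ.* N) r))))))
  base-nonneg : 0ℚ ≤ c₀ * (d * d) * q
  base-nonneg = *-nonneg (*-nonneg 0≤c₀ (*-nonneg 0≤d 0≤d)) (ℕ→ℚ-nonneg (4 ℕ.* N))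
  base≤ : c₀ * (d * d) * q ≤ + 1 / 14
  base≤ = begin
    c₀ * (d * d) * q
      ≤⟨ ℚ.*-monoʳ-≤-nonNeg q {{nonNegative (ℕ→ℚ-nonneg (4 ℕ.* N))}} (*-monoˡ c₀ 0≤c₀ (*-mono 0≤d (≤-trans 0≤d d≤3η) d≤3η d≤3η)) ⟩
    c₀ * ((+ 3 / 1 * η) * (+ 3 / 1 * η)) * q
      ≡⟨ cong (c₀ * ((+ 3 / 1 * η) * (+ 3 / 1 * η)) *_) (ℕ→ℚ-* 4 N) ⟩
    c₀ * ((+ 3 / 1 * η) * (+ 3 / 1 * η)) * (+ 4 / 1 * ℕ→ℚ N)
      -- 720 is 9 · 4 · 20: the square of 3η contributes 9, `q` contributes 4, and 1/20 is 5 ·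
      -- (1/10)².
      ≡⟨ solve 3 (λ c η N → c :* ((con (+ 3 / 1) :* η) :* (con (+ 3 / 1) :* η)) :* (con (+ 4 / 1) :* N)
           := (con (+ 720 / 1) :* c) :* (N :* (con (+ 5 / 1) :* ((con (+ 1 / 10) :* η) :* (con (+ 1 / 10) :* η))))) refl c₀ η (ℕ→ℚ N) ⟩
    + 720 / 1 * c₀ * (ℕ→ℚ N * (+ 5 / 1 * ((+ 1 / 10 * η) * (+ 1 / 10 * η))))
      ≡⟨ cong (_* (ℕ→ℚ N * (+ 5 / 1 * ((+ 1 / 10 * η) * (+ 1 / 10 * η))))) 720c₀ ⟩
    + 1 / 28 * (ℕ→ℚ N * (+ 5 / 1 * ((+ 1 / 10 * η) * (+ 1 / 10 * η))))
      ≤⟨ *-monoˡ (+ 1 / 28) (ℚ.nonNegative⁻¹ (+ 1 / 28)) N≤ ⟩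
    + 1 / 28 * (+ 2 / 1) ∎

-- For s = ⌊n / D_r⌋, s · D_r ≤ n feeds `bound` and n < (s+1) · D_r feeds `rate-bound`.
exponential-bound : ∀ r → 1 ℕ.≤ r → ∀ η → 0ℚ < η → ∀ {m} n (P : Fin n → 𝔽₂^ m → 𝔽₂) →
  (∀ i → Rank≤ r full 0ᵥ (P i)) → (∀ i V h → η ≤ ∣ 𝔼 V h (𝟙 ∘ P i) - ⅓ ∣) →
  ∃[ s ] affinity full 0ᵥ P ≤ ½ ^ s × (∀ {d} → 0ℚ ≤ d → d ≤ + 3 / 1 * η → rate r d n ≤ ℕ→ℚ (suc s))
-- Without functions there is no bias to force η ≤ 1; the rate is then 0 and s = 0 works.
exponential-bound r 1≤r η 0<η zero P rank far = 0 , affinity≤1 full 0ᵥ P , λ {d} _ _ →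
  ≤-trans (≤-reflexive (ℚ.*-zeroʳ (c₀ ^ r * d ^ (2 ℕ.* r) * _/_ (+ 1) (r !) {{r ℕ.!≢0}}))) (ℕ→ℚ-nonneg 1)
exponential-bound r 1≤r η 0<η n@(suc _) P rank far with archimedean x 0<x
  where
  e x : ℚ
  e = + 1 / 10 * η
  x = + 5 / 1 * (e * e)
  0<e : 0ℚ < e
  0<e = ℚ.positive⁻¹ e {{ℚ.pos*pos⇒pos (+ 1 / 10) η {{positive 0<η}}}}
  0<x : 0ℚ < x
  0<x = ℚ.positive⁻¹ x {{ℚ.pos*pos⇒pos (+ 5 / 1) (e * e) {{ℚ.pos*pos⇒pos e {{positive 0<e}} e {{positive 0<e}}}}}}
... | N , 1≤Nx , Nx≤2 = s , B.bound r s full 0ᵥ rank (ℕ.m/n*n≤m n (B.D r)) ,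
  λ 0≤d d≤3η → rate-bound r 1≤r {η = η} 0≤d d≤3η N s n (Nx≤2 x≤1) (ℕ.<⇒≤ (m<[1+m/n]*n n (B.D r)))
  where
  e : ℚ
  e = + 1 / 10 * η
  0≤e : 0ℚ ≤ e
  0≤e = *-nonneg (ℚ.nonNegative⁻¹ (+ 1 / 10)) (ℚ.<⇒≤ 0<η)
  e≤ : e ≤ + 1 / 10
  e≤ = *-monoˡ (+ 1 / 10) (ℚ.nonNegative⁻¹ (+ 1 / 10)) (≤-trans (far zero full 0ᵥ) (bias≤1 full 0ᵥ (P zero)))
  x≤1 : + 5 / 1 * (e * e) ≤ 1ℚ
  x≤1 = ≤-trans (*-monoˡ (+ 5 / 1) (ℚ.nonNegative⁻¹ (+ 5 / 1)) (*-mono 0≤e (ℚ.nonNegative⁻¹ (+ 1 / 10)) e≤ e≤))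
                (toWitness {a? = + 5 / 1 * (+ 1 / 10 * (+ 1 / 10)) ℚ.≤? 1ℚ} _)
  module B = Bound e 0≤e e≤ N 1≤Nx P
    (λ i V h → subst (_≤ ∣ 𝔼 V h (𝟙 ∘ P i) - ⅓ ∣) (solve 1 (λ η → η := con (+ 10 / 1) :* (con (+ 1 / 10) :* η)) refl η) (far i V h))
  instance
    D≢0 : ℕ.NonZero (B.D r)
    D≢0 = ℕ.m*n≢0 (14 ℕ.* (4 ℕ.* N) ℕ.^ r) (r !)
      {{ℕ.m*n≢0 14 ((4 ℕ.* N) ℕ.^ r) {{_}} {{ℕ.m^n≢0 (4 ℕ.* N) r {{ℕ.m*n≢0 4 N {{_}} {{ℕ.>-nonZero B.N-pos}}}}}}}} {{r ℕ.!≢0}}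
  s : ℕ
  s = n ℕ./ B.D r

-- The exponent for real δ.

target : ℕ → ℝ → ℕ → ℝ
target r δ n = -ᵣ (ι c₀ ^ᵣ r *ᵣ δ ^ᵣ (2 ℕ.* r) *ᵣ 1/ r !ᵣ *ᵣ fromℕ n) +ᵣ fromℕ r

target-seq : ∀ r δ n i → seq (target r δ n) i ≡ - rate r (seq δ i) n + ℕ→ℚ r
target-seq r δ n i = cong₂ (λ a b → - (a * b * _/_ (+ 1) (r !) {{r ℕ.!≢0}} * ℕ→ℚ n) + ℕ→ℚ r)
                           (seq-^ (ι c₀) r i) (seq-^ δ (2 ℕ.* r) i)

-- At an index past both `M` and `N` the exponent is at least -s and `p` lies above it, so `½^≤2^`
-- applies.
½^≤2^target : ∀ r → 1 ℕ.≤ r → ∀ δ n s {M} → (∀ i → M ℕ.≤ i → rate r (seq δ i) n ≤ ℕ→ℚ (suc s)) →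
              ∀ {W} → 0ℚ ≤ W → W ≤ ½ ^ s → W ≤2^ target r δ n
½^≤2^target r 1≤r δ n s {M} rate≤ 0≤W W≤ p (ε , 0<ε , N , x+ε≤p) = ½^≤2^ s 0≤W W≤ p (begin
  - ℕ→ℚ s                     ≡⟨ solve 1 (λ s → :- s := :- (con 1ℚ :+ s) :+ con 1ℚ) refl (ℕ→ℚ s) ⟩
  - (1ℚ + ℕ→ℚ s) + 1ℚ         ≡⟨ cong (λ z → - z + 1ℚ) (sym (ℕ→ℚ-+ 1 s)) ⟩
  -- The rate is bounded only by s + 1 because of rounding; the summand `r`, at least 1, restores
  -- the difference.
  - ℕ→ℚ (suc s) + 1ℚ          ≤⟨ +-mono-≤ (ℚ.neg-antimono-≤ (rate≤ i (ℕ.m≤m⊔n M N))) (ℕ→ℚ-mono 1≤r) ⟩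
  - C + ℕ→ℚ r                 ≤⟨ ≤-by ε (ℚ.<⇒≤ 0<ε) refl ⟩
  - C + ℕ→ℚ r + ε             ≡⟨ cong (_+ ε) (sym (target-seq r δ n i)) ⟩
  seq (target r δ n) i + ε    ≤⟨ x+ε≤p i (ℕ.m≤n⊔m M N) ⟩
  p                           ∎)
  where
  open ℚ.≤-Reasoning
  i : ℕ
  i = M ℕ.⊔ N
  C : ℚ
  C = rate r (seq δ i) n

affinity-bound : ∀ r → 1 ℕ.≤ r → ∀ δ → ι 0ℚ <ᵣ δ → ∀ {m} n (P : Fin n → 𝔽₂^ m → 𝔽₂) →
  (∀ i → Rank≤ r full 0ᵥ (P i)) → (∀ i V h → δ ≤ᵣ ι ∣ 𝔼 V h (𝟙 ∘ P i) - ⅓ ∣) →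
  affinity full 0ᵥ P ≤2^ target r δ n
affinity-bound r 1≤r δ 0<δ n P rank far =
  let η , 0<η , (M , δ-bounds) , below = rational-below δ 0<δ
      s , small , rate≤ = exponential-bound r 1≤r η 0<η n P rank (λ i V h → below ∣ 𝔼 V h (𝟙 ∘ P i) - ⅓ ∣ (far i V h))
  in ½^≤2^target r 1≤r δ n s {M} (λ i M≤i → rate≤ (proj₁ (δ-bounds i M≤i)) (proj₂ (δ-bounds i M≤i)))
       (affinity-nonneg full 0ᵥ P) small

theorem8p1 : ∃[ c ] (ι 0ℚ <ᵣ c ×
    (∀ (r : ℕ) → 1 ℕ.≤ r → (δ : ℝ) → ι 0ℚ <ᵣ δ →
    ∀ (m n : ℕ) (P : Fin n → 𝔽₂^ m → 𝔽₂) →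
    (∀ i → ∃[ k ] (Rank₁ (P i) k × k ℕ.≤ r)) →
    (∀ i (V : Subspace m) (h : 𝔽₂^ m) → δ ≤ᵣ ι (TV₁ (cosetLaw V h (P i)) (Ber ⅓))) →
    (1ℚ - TVⁿ (jointLaw P) (Ber ⅓ ⊗^ n))
    ≤2^ (-ᵣ (c ^ᵣ r *ᵣ δ ^ᵣ (2 ℕ.* r) *ᵣ 1/ r !ᵣ *ᵣ fromℕ n) +ᵣ fromℕ r)))
theorem8p1 = ι c₀ , (c₀ , 0<c₀ , 0 , λ _ _ → ≤-reflexive (ℚ.+-identityˡ c₀)) ,
  λ r 1≤r δ 0<δ m n P rank far → subst (_≤2^ target r δ n) (sym (TV-affinity P))
    (affinity-bound r 1≤r δ 0<δ n P
      (λ i → let _ , rank₁ , k≤r = rank i in rank₁⇒rank≤ {V = full} {h = 0ᵥ} rank₁ k≤r)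
      (λ i V h → subst (λ q → δ ≤ᵣ ι q) (TV₁-coset V h (P i)) (far i V h)))
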